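{- Let $t\ge 17$ be an odd integer, put $n=5t-10$, and define $$S_t=\{t-4,\,t-3\}\cup [t+1,(3t-9)/2]_{\mathbb Z}\cup\{(3t-5)/2,\,2t-4\}.$$ Then the circulant graph $G_t=\operatorname{Circ}(n,S_t)$ is doubly saturated $R(3,t)$-good. More precisely: (1) $G_t$ is triangle-free. (2) $\alpha(G_t)=t-1$, where $\alpha$ denotes the independence number. (3) Adding any nonedge to $G_t$ creates a triangle. (4) Deleting any edge from $G_t$ creates an independent set of order $t$.
   Context: Graphs are finite and simple. For integers $a\le b$, $[a,b]_{\mathbb Z}=\{a,a+1,\dots,b\}$. For $n\ge 3$ and $S\subseteq\{1,\dots,\lfloor n/2\rfloor\}$, $\operatorname{Circ}(n,S)$ is the graph with vertex set $\mathbb Z/n\mathbb Z$ in which $x$ and $y$ are adjacent exactly when their least circular distance belongs to $S$ (the least circular distance of $x,y$ is $\min(k,n-k)$, where $k\in\{0,\dots,n-1\}$ represents $y-x$ modulo $n$). A graph is $R(s,t)$-good if it contains neither a clique of order $s$ nor an independent set of order $t$. It is doubly saturated $R(s,t)$-good if it is $R(s,t)$-good, adding any missing edge destroys that property, and deleting any existing edge also destroys that property. -}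

module Defs where

open import Data.Fin.Base using (Fin; toℕ)
open import Data.Fin.Properties using (toℕ<n; nonZeroIndex) renaming (_≟_ to _≟ᶠ_)
open import Data.Fin.Subset using (Subset; _∈_; ∣_∣)
open import Data.Nat.Base
open import Data.Nat.DivMod using (_%_; _/_; [m+n]%n≡m%n; m<n⇒m%n≡m; n%n≡0; m*n/n≡m; /-monoˡ-≤)
open import Data.Nat.Properties
open import Data.Product.Base using (∃-syntax; _×_; _,_)
open import Data.Sum.Base using (_⊎_; inj₁; inj₂) renaming (map to map⊎)
open import Level using (0ℓ)
open import Relation.Binary.Core using (Rel)
open import Relation.Binary.Definitions using (Symmetric; Irreflexive; tri<; tri≈; tri>)
  renaming (Decidable to Decidable₂)
open import Relation.Binary.PropositionalEquality
open import Relation.Nullary using (¬_; ¬?; _×-dec_; _⊎-dec_)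
open import Relation.Unary using (Pred; Decidable; _⊆_; _∪_; ｛_｝)
open import Relation.Unary.Properties using (_∪?_)

------------------------------------------------------------------------
-- Finite simple graphs

record Graph (n : ℕ) : Set₁ where
  field
    Adj        : Rel (Fin n) 0ℓ
    adj?       : Decidable₂ Adj
    adj-sym    : Symmetric Adj
    adj-irrefl : Irreflexive _≡_ Adj

open Graph public using (Adj)

module _ {n : ℕ} where

  IsClique : Graph n → Subset n → Set
  IsClique G p = ∀ {x y} → x ∈ p → y ∈ p → x ≢ y → Adj G x y

  IsIndependent : Graph n → Subset n → Set
  IsIndependent G p = ∀ {x y} → x ∈ p → y ∈ p → ¬ Adj G x y

  HasClique : ℕ → Graph n → Set
  HasClique s G = ∃[ p ] IsClique G p × ∣ p ∣ ≡ s

  HasIndependentSet : ℕ → Graph n → Set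
  HasIndependentSet t G = ∃[ p ] IsIndependent G p × ∣ p ∣ ≡ t

  HasTriangle : Graph n → Set
  HasTriangle G = ∃[ x ] ∃[ y ] ∃[ z ] Adj G x y × Adj G y z × Adj G x z

  TriangleFree : Graph n → Set
  TriangleFree G = ¬ HasTriangle G

  -- α(G) = m, i.e. m is the maximum order of an independent set.
  IndependenceNumber : Graph n → ℕ → Set
  IndependenceNumber G m =
    HasIndependentSet m G × (∀ p → IsIndependent G p → ∣ p ∣ ≤ m)

  -- {u , v} = {x , y} as unordered pairs.
  SamePair : (x y u v : Fin n) → Set
  SamePair x y u v = (u ≡ x × v ≡ y) ⊎ (u ≡ y × v ≡ x)

  samePair? : ∀ x y → Decidable₂ (SamePair x y)
  samePair? x y u v =
    ((u ≟ᶠ x) ×-dec (v ≟ᶠ y)) ⊎-dec ((u ≟ᶠ y) ×-dec (v ≟ᶠ x))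

  samePair-sym : ∀ {x y} → Symmetric (SamePair x y)
  samePair-sym (inj₁ (p , q)) = inj₂ (q , p)
  samePair-sym (inj₂ (p , q)) = inj₁ (q , p)

  addEdge : (G : Graph n) (x y : Fin n) → x ≢ y → Graph n
  addEdge G x y x≢y = record
    { Adj        = λ u v → Adj G u v ⊎ SamePair x y u v
    ; adj?       = λ u v → Graph.adj? G u v ⊎-dec samePair? x y u v
    ; adj-sym    = map⊎ (Graph.adj-sym G) samePair-sym
    ; adj-irrefl = λ where
        u≡v  (inj₁ e)                    → Graph.adj-irrefl G u≡v e
        refl (inj₂ (inj₁ (refl , refl))) → x≢y refl
        refl (inj₂ (inj₂ (refl , refl))) → x≢y refl
    }

  deleteEdge : (G : Graph n) (x y : Fin n) → Graph n
  deleteEdge G x y = record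
    { Adj        = λ u v → Adj G u v × ¬ SamePair x y u v
    ; adj?       = λ u v → Graph.adj? G u v ×-dec ¬? (samePair? x y u v)
    ; adj-sym    = λ (e , ≠) → Graph.adj-sym G e , λ s → ≠ (samePair-sym s)
    ; adj-irrefl = λ u≡v (e , _) → Graph.adj-irrefl G u≡v e
    }

  Good : (s t : ℕ) → Graph n → Set
  Good s t G = ¬ HasClique s G × ¬ HasIndependentSet t G

  DoublySaturatedGood : (s t : ℕ) → Graph n → Set
  DoublySaturatedGood s t G =
      Good s t G
    × (∀ x y (x≢y : x ≢ y) → ¬ Adj G x y → ¬ Good s t (addEdge G x y x≢y))
    × (∀ x y → Adj G x y → ¬ Good s t (deleteEdge G x y))

------------------------------------------------------------------------
-- Circulant graphs

[_⋯_] : ℕ → ℕ → Pred ℕ 0ℓ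
[ a ⋯ b ] k = a ≤ k × k ≤ b

[_⋯_]? : ∀ a b → Decidable [ a ⋯ b ]
[ a ⋯ b ]? k = (a ≤? k) ×-dec (k ≤? b)

-- The representative in {0,…,n-1} of y - x modulo n.
residue : ∀ {n} → Fin n → Fin n → ℕ
residue {n} x y = (toℕ y + (n ∸ toℕ x)) % n
  where instance _ = nonZeroIndex x

circDist : ∀ {n} → Fin n → Fin n → ℕ
circDist {n} x y = residue x y ⊓ (n ∸ residue x y)

private
  residue-refl : ∀ {n} (x : Fin n) → residue x x ≡ 0
  residue-refl {n} x =
    trans (cong (_% n) (m+[n∸m]≡n (<⇒≤ (toℕ<n x)))) (n%n≡0 n)
    where instance _ = nonZeroIndex x

  residue-< : ∀ {n} (x y : Fin n) → toℕ x < toℕ y →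
              residue x y ≡ toℕ y ∸ toℕ x
  residue-< {n} x y x<y = begin
    (b + (n ∸ a)) % n  ≡⟨ cong (_% n) (+-∸-assoc b (<⇒≤ (toℕ<n x))) ⟨
    (b + n ∸ a) % n    ≡⟨ cong (_% n) (+-∸-comm n (<⇒≤ x<y)) ⟩
    (b ∸ a + n) % n    ≡⟨ [m+n]%n≡m%n (b ∸ a) n ⟩
    (b ∸ a) % n        ≡⟨ m<n⇒m%n≡m (≤-<-trans (m∸n≤m b a) (toℕ<n y)) ⟩
    b ∸ a              ∎
    where
    open ≡-Reasoning
    a = toℕ x
    b = toℕ y
    instance _ = nonZeroIndex x

  residue-> : ∀ {n} (x y : Fin n) → toℕ y < toℕ x →
              residue x y ≡ n ∸ (toℕ x ∸ toℕ y)
  residue-> {n} x y y<x = begin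
    (b + (n ∸ a)) % n    ≡⟨ cong (_% n) eq ⟩
    (n ∸ (a ∸ b)) % n    ≡⟨ m<n⇒m%n≡m (∸-monoʳ-< (m<n⇒0<n∸m y<x) a∸b≤n) ⟩
    n ∸ (a ∸ b)          ∎
    where
    open ≡-Reasoning
    a = toℕ x
    b = toℕ y
    instance _ = nonZeroIndex x
    a∸b≤n : a ∸ b ≤ n
    a∸b≤n = ≤-trans (m∸n≤m a b) (<⇒≤ (toℕ<n x))
    eq : b + (n ∸ a) ≡ n ∸ (a ∸ b)
    eq = begin
      b + (n ∸ a)                ≡⟨ m+n∸n≡m (b + (n ∸ a)) (a ∸ b) ⟨
      b + (n ∸ a) + (a ∸ b) ∸ (a ∸ b)
        ≡⟨ cong (_∸ (a ∸ b)) (cong (_+ (a ∸ b)) (+-comm b (n ∸ a))) ⟩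
      n ∸ a + b + (a ∸ b) ∸ (a ∸ b)
        ≡⟨ cong (_∸ (a ∸ b)) (+-assoc (n ∸ a) b (a ∸ b)) ⟩
      n ∸ a + (b + (a ∸ b)) ∸ (a ∸ b)
        ≡⟨ cong (λ c → n ∸ a + c ∸ (a ∸ b)) (m+[n∸m]≡n (<⇒≤ y<x)) ⟩
      n ∸ a + a ∸ (a ∸ b)
        ≡⟨ cong (_∸ (a ∸ b)) (m∸n+n≡m (<⇒≤ (toℕ<n x))) ⟩
      n ∸ (a ∸ b)                ∎

  circDist-sym-< : ∀ {n} (x y : Fin n) → toℕ x < toℕ y →
                   circDist x y ≡ circDist y x
  circDist-sym-< {n} x y x<y
    rewrite residue-< x y x<y | residue-> y x x<y
          | m∸[m∸n]≡n (≤-trans (m∸n≤m (toℕ y) (toℕ x)) (<⇒≤ (toℕ<n y)))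
    = ⊓-comm (toℕ y ∸ toℕ x) _

circDist-refl : ∀ {n} (x : Fin n) → circDist x x ≡ 0
circDist-refl x rewrite residue-refl x = refl

circDist-sym : ∀ {n} (x y : Fin n) → circDist x y ≡ circDist y x
circDist-sym x y with <-cmp (toℕ x) (toℕ y)
... | tri< x<y _ _ = circDist-sym-< x y x<y
... | tri> _ _ y<x = sym (circDist-sym-< y x y<x)
... | tri≈ _ x≡y _ rewrite x≡y = refl

-- Vertices are the residues 0,…,n-1 of ℤ/nℤ.
Circ : (n : ℕ) → 3 ≤ n → (S : Pred ℕ 0ℓ) → Decidable S →
       S ⊆ [ 1 ⋯ n / 2 ] → Graph n
Circ n _ S S? S⊆ = record
  { Adj        = λ x y → S (circDist x y)
  ; adj?       = λ x y → S? (circDist x y)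
  ; adj-sym    = λ {x} {y} → subst S (circDist-sym x y)
  ; adj-irrefl = λ { {x} refl d → 0∉S (subst S (circDist-refl x) d) }
  }
  where
  0∉S : ¬ S 0
  0∉S 0∈S with S⊆ 0∈S
  ... | () , _

------------------------------------------------------------------------
-- The family G_t

order : ℕ → ℕ
order t = 5 * t ∸ 10

-- For odd t ≥ 17 no subtraction truncates and both halvings are exact.
S : ℕ → Pred ℕ 0ℓ
S t = (｛ t ∸ 4 ｝ ∪ ｛ t ∸ 3 ｝)
    ∪ [ t + 1 ⋯ (3 * t ∸ 9) / 2 ]
    ∪ (｛ (3 * t ∸ 5) / 2 ｝ ∪ ｛ 2 * t ∸ 4 ｝)

S? : ∀ t → Decidable (S t)
S? t = (((t ∸ 4) ≟_) ∪? ((t ∸ 3) ≟_))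
    ∪? ([ t + 1 ⋯ (3 * t ∸ 9) / 2 ]?
    ∪? ((((3 * t ∸ 5) / 2) ≟_) ∪? ((2 * t ∸ 4) ≟_)))

3≤order : ∀ {t} → 17 ≤ t → 3 ≤ order t
3≤order {t} 17≤t =
  ≤-trans (m≤m+n 3 72) (∸-monoˡ-≤ 10 (*-monoʳ-≤ 5 17≤t))

S⊆ : ∀ {t} → 17 ≤ t → S t ⊆ [ 1 ⋯ order t / 2 ]
S⊆ {t} 17≤t = λ where
    (inj₁ (inj₁ refl)) → ≤-trans (m≤m+n 1 12) (∸-monoˡ-≤ 4 17≤t)
                       , ≤-trans (∸-monoˡ-≤ 4 (m≤n*m t 2)) top
    (inj₁ (inj₂ refl)) → ≤-trans (m≤m+n 1 13) (∸-monoˡ-≤ 3 17≤t)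
                       , ≤-trans t∸3≤ top
    (inj₂ (inj₁ (lo , hi))) → ≤-trans (m≤n+m 1 t) lo
                            , ≤-trans hi (/-monoˡ-≤ 2 (≤-trans (∸-monoʳ-≤ (3 * t) (m≤m+n 5 4)) 3t∸5≤))
    (inj₂ (inj₂ (inj₁ refl))) → ≤-trans (m≤m+n 1 22) (/-monoˡ-≤ 2 (∸-monoˡ-≤ 5 (*-monoʳ-≤ 3 17≤t)))
                              , /-monoˡ-≤ 2 3t∸5≤
    (inj₂ (inj₂ (inj₂ refl))) → ≤-trans (m≤m+n 1 29) (∸-monoˡ-≤ 4 (*-monoʳ-≤ 2 17≤t))
                              , top
  where
  open ≤-Reasoning

  3t∸5≤ : 3 * t ∸ 5 ≤ order t
  3t∸5≤ = begin
    3 * t ∸ 5            ≡⟨ [m+n]∸[m+o]≡n∸o 5 (3 * t) 5 ⟨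
    5 + 3 * t ∸ 10       ≤⟨ ∸-monoˡ-≤ 10 (+-monoˡ-≤ (3 * t) (≤-trans (m≤m+n 5 29) (*-monoʳ-≤ 2 17≤t))) ⟩
    2 * t + 3 * t ∸ 10   ≡⟨ cong (_∸ 10) (*-distribʳ-+ t 2 3) ⟨
    5 * t ∸ 10           ∎

  top : 2 * t ∸ 4 ≤ order t / 2
  top = begin
    2 * t ∸ 4              ≡⟨ m*n/n≡m (2 * t ∸ 4) 2 ⟨
    (2 * t ∸ 4) * 2 / 2    ≤⟨ /-monoˡ-≤ 2 dbl ⟩
    order t / 2            ∎
    where
    dbl : (2 * t ∸ 4) * 2 ≤ order t
    dbl = begin
      (2 * t ∸ 4) * 2     ≡⟨ *-distribʳ-∸ 2 (2 * t) 4 ⟩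
      2 * t * 2 ∸ 8       ≡⟨ cong (_∸ 8) (trans (*-comm (2 * t) 2) (sym (*-assoc 2 2 t))) ⟩
      4 * t ∸ 8           ≡⟨ [m+n]∸[m+o]≡n∸o 2 (4 * t) 8 ⟨
      2 + 4 * t ∸ 10      ≤⟨ ∸-monoˡ-≤ 10 (+-monoˡ-≤ (4 * t) (≤-trans (m≤m+n 2 15) 17≤t)) ⟩
      t + 4 * t ∸ 10      ∎

  t∸3≤ : t ∸ 3 ≤ 2 * t ∸ 4
  t∸3≤ = begin
    t ∸ 3              ≡⟨ [m+n]∸[m+o]≡n∸o 1 t 3 ⟨
    1 + t ∸ 4          ≤⟨ ∸-monoˡ-≤ 4 (+-monoˡ-≤ t (≤-trans (m≤m+n 1 16) 17≤t)) ⟩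
    t + t ∸ 4          ≡⟨ cong (λ u → t + u ∸ 4) (+-identityʳ t) ⟨
    2 * t ∸ 4          ∎

circulantG : (t : ℕ) → 17 ≤ t → Graph (order t)
circulantG t 17≤t = Circ (order t) (3≤order 17≤t) (S t) (S? t) (S⊆ 17≤t)

{-# OPTIONS --safe #-}
module Submission where

-- Put q = t - 2, so that n = 5 q, and let C = S ∪ (n - S).  Then C meets every coset of qℤ in one
-- element, except that it meets qℤ in 2 q and 3 q.  So each coset induces a 5-cycle, and an
-- independent set I contains at most two of its vertices, and if two, then some x and x + q.  If this
-- never happens, |I| ≤ q.  Otherwise translate I such that 0 , q ∈ I.  Write q = 2 h + 1 and let u j
-- and v j be the traces of I on the cosets of j and of h + j.  Whether two traces are compatible
-- depends only on whether their indices are equal, at distance 1 or 2, or further apart, but for some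
-- exceptions at the ends.  Hence the columns (u j , v j) can be read by an automaton that does not
-- depend on t, and a finite set of its states that is closed under transitions shows that
-- |u 1| + |v 1| + … + |u h| + |v h| ≤ 2 h, so |I| ≤ 2 + 2 h = t - 1.
--
-- Everything else is linear arithmetic in h and is decided by Fourier–Motzkin elimination: C is
-- sum-free, non-adjacent vertices have a common neighbour from a short list, and each edge {0 , d}
-- is the only edge within an explicit set of t vertices, made of at most eight intervals.

open import Defs
open import Data.Nat.Base using (ℕ; _≤_; _∸_)
open import Data.Nat.DivMod using (_%_)
open import Data.Product.Base using (_×_)
open import Relation.Binary.PropositionalEquality using (_≡_; _≢_)
open import Relation.Nullary using (¬_)

-- For 0 < r < q write the element of C in the class of r as r + c q. Then c is 4 for r ≤ 2, 1 up to
-- h - 1, 3 at h, 1 at h + 1, 3 up to 2 h - 2, and 0 for the last two r. Two cosets whose indices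
-- differ by r are thus joined by a perfect matching, the shift by c, so constraints link all pairs
-- of cosets, however distant. Folding the indices at h makes this manageable: within a half only
-- near or far matters; across the halves the shift is irregular only on or next to the diagonal and
-- at the ends, and the pairs at the ends all involve u 1, v 1 or v 2. A column acts in the same way
-- on all columns three or more later, so its effect can be accumulated in upper bounds for the
-- columns to come. Having 0 and q in I leaves three of the five places in every other coset. A
-- single column can still hold four vertices, so columns cannot be bounded one by one; what is
-- propagated is the surplus of the running total.

-- Linear arithmetic over ℕ by reflection

module LinearArithmetic where

  open import Data.Bool.Base using (Bool; true; false; _∧_; _∨_; not; if_then_else_)
  open import Data.Empty using (⊥; ⊥-elim)
  open import Data.Integer.Base as ℤ using (ℤ; +_; -[1+_])
  import Data.Integer.Properties as ℤP
  open import Data.Integer.Tactic.RingSolver using (solve-∀)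
  open import Data.List.Base as List using (List; []; _∷_; _++_)
  open import Data.List.Relation.Unary.All as All using (All; []; _∷_)
  open import Data.List.Relation.Unary.All.Properties using (++⁺)
  open import Data.Maybe.Base using (Maybe; just; nothing)
  open import Data.Nat.Base as ℕ using (ℕ; zero; suc; _+_; _*_; _≤_)
  import Data.Nat.Properties as ℕP
  open import Data.Product.Base using (_×_; _,_; proj₁; proj₂)
  open import Data.Sum.Base using (_⊎_; inj₁; inj₂)
  open import Data.Unit.Base using (⊤; tt)
  open import Relation.Binary.PropositionalEquality
  open import Relation.Binary.Definitions using (tri<; tri≈; tri>)

  infix 4 _⊹_
  infixl 7 _:*_
  infixl 6 _:+_
  infix 4 _:≤_ _:≡_
  infixr 3 _:∧_
  infixr 2 _:∨_

  data Exp : Set where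
    var lit : ℕ → Exp
    _:+_    : Exp → Exp → Exp
    _:*_    : ℕ → Exp → Exp

  data Formula : Set where
    _:≤_ _:≡_ : Exp → Exp → Formula
    _:∧_ _:∨_ : Formula → Formula → Formula
    :⊥ :⊤     : Formula

  Env : Set
  Env = List ℕ

  head : Env → ℕ
  head []      = 0
  head (x ∷ _) = x

  tail : Env → Env
  tail []      = []
  tail (_ ∷ ρ) = ρ

  lookup : Env → ℕ → ℕ
  lookup ρ zero    = head ρ
  lookup ρ (suc i) = lookup (tail ρ) i

  ⟦_⟧ᵉ : Exp → Env → ℕ
  ⟦ var i ⟧ᵉ   ρ = lookup ρ i
  ⟦ lit k ⟧ᵉ   ρ = k
  ⟦ a :+ b ⟧ᵉ  ρ = ⟦ a ⟧ᵉ ρ + ⟦ b ⟧ᵉ ρ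
  ⟦ k :* a ⟧ᵉ  ρ = k * ⟦ a ⟧ᵉ ρ

  ⟦_⟧ : Formula → Env → Set
  ⟦ a :≤ b ⟧ ρ = ⟦ a ⟧ᵉ ρ ≤ ⟦ b ⟧ᵉ ρ
  ⟦ a :≡ b ⟧ ρ = ⟦ a ⟧ᵉ ρ ≡ ⟦ b ⟧ᵉ ρ
  ⟦ φ :∧ ψ ⟧ ρ = ⟦ φ ⟧ ρ × ⟦ ψ ⟧ ρ
  ⟦ φ :∨ ψ ⟧ ρ = ⟦ φ ⟧ ρ ⊎ ⟦ ψ ⟧ ρ
  ⟦ :⊥ ⟧     ρ = ⊥
  ⟦ :⊤ ⟧     ρ = ⊤

  -- Strict inequalities are strengthened to `1 + b ≤ a`, here and in `:<`. This is where
  -- integrality enters; the elimination itself is rational.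
  negate : Formula → Formula
  negate (a :≤ b) = lit 1 :+ b :≤ a
  negate (a :≡ b) = lit 1 :+ a :≤ b :∨ lit 1 :+ b :≤ a
  negate (φ :∧ ψ) = negate φ :∨ negate ψ
  negate (φ :∨ ψ) = negate φ :∧ negate ψ
  negate :⊥       = :⊤
  negate :⊤       = :⊥

  decide : ∀ φ ρ → ⟦ φ ⟧ ρ ⊎ ⟦ negate φ ⟧ ρ
  decide (a :≤ b) ρ = ℕP.≤-<-connex _ _
  decide (a :≡ b) ρ with ℕP.<-cmp (⟦ a ⟧ᵉ ρ) (⟦ b ⟧ᵉ ρ)
  ... | tri< p _ _ = inj₂ (inj₁ p)
  ... | tri≈ _ p _ = inj₁ p
  ... | tri> _ _ p = inj₂ (inj₂ p)
  decide (φ :∧ ψ) ρ with decide φ ρ | decide ψ ρ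
  ... | inj₁ p | inj₁ q = inj₁ (p , q)
  ... | inj₂ p | _      = inj₂ (inj₁ p)
  ... | inj₁ _ | inj₂ q = inj₂ (inj₂ q)
  decide (φ :∨ ψ) ρ with decide φ ρ | decide ψ ρ
  ... | inj₁ p | _      = inj₁ (inj₁ p)
  ... | inj₂ _ | inj₁ q = inj₁ (inj₂ q)
  ... | inj₂ p | inj₂ q = inj₂ (p , q)
  decide :⊥ ρ = inj₂ tt
  decide :⊤ ρ = inj₁ tt

  -- A row k ⊹ (c₀ ∷ c₁ ∷ …) is the affine form k + c₀ x₀ + c₁ x₁ + …
  data Row : Set where
    _⊹_ : ℤ → List ℤ → Row

  -- Missing coefficients and missing variables both count as 0, so rows and environments of any
  -- lengths fit together.
  dot : List ℤ → Env → ℤ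
  dot []       ρ = + 0
  dot (c ∷ cs) ρ = c ℤ.* + head ρ ℤ.+ dot cs (tail ρ)

  value : Row → Env → ℤ
  value (k ⊹ cs) ρ = k ℤ.+ dot cs ρ

  combine : ℤ → List ℤ → ℤ → List ℤ → List ℤ
  combine a []       b []       = []
  combine a []       b (d ∷ ds) = b ℤ.* d ∷ combine a [] b ds
  combine a (c ∷ cs) b []       = a ℤ.* c ∷ combine a cs b []
  combine a (c ∷ cs) b (d ∷ ds) = a ℤ.* c ℤ.+ b ℤ.* d ∷ combine a cs b ds

  combineRow : ℤ → Row → ℤ → Row → Row
  combineRow a (k ⊹ cs) b (l ⊹ ds) = a ℤ.* k ℤ.+ b ℤ.* l ⊹ combine a cs b ds

  private
    r₀ : ∀ a b → + 0 ≡ a ℤ.* + 0 ℤ.+ b ℤ.* + 0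
    r₀ = solve-∀

    r₁ : ∀ a b d x y → b ℤ.* d ℤ.* x ℤ.+ (a ℤ.* + 0 ℤ.+ b ℤ.* y) ≡
         a ℤ.* + 0 ℤ.+ b ℤ.* (d ℤ.* x ℤ.+ y)
    r₁ = solve-∀

    r₂ : ∀ a b c x y → a ℤ.* c ℤ.* x ℤ.+ (a ℤ.* y ℤ.+ b ℤ.* + 0) ≡
         a ℤ.* (c ℤ.* x ℤ.+ y) ℤ.+ b ℤ.* + 0
    r₂ = solve-∀

    r₃ : ∀ a b c d x y z →
         (a ℤ.* c ℤ.+ b ℤ.* d) ℤ.* x ℤ.+ (a ℤ.* y ℤ.+ b ℤ.* z) ≡
         a ℤ.* (c ℤ.* x ℤ.+ y) ℤ.+ b ℤ.* (d ℤ.* x ℤ.+ z)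
    r₃ = solve-∀

    r₄ : ∀ a k y b l z → a ℤ.* k ℤ.+ b ℤ.* l ℤ.+ (a ℤ.* y ℤ.+ b ℤ.* z) ≡
         a ℤ.* (k ℤ.+ y) ℤ.+ b ℤ.* (l ℤ.+ z)
    r₄ = solve-∀

  dot-combine : ∀ a cs b ds ρ →
    dot (combine a cs b ds) ρ ≡ a ℤ.* dot cs ρ ℤ.+ b ℤ.* dot ds ρ
  dot-combine a []       b []       ρ = r₀ a b
  dot-combine a []       b (d ∷ ds) ρ =
    trans (cong (ℤ._+_ (b ℤ.* d ℤ.* + head ρ)) (dot-combine a [] b ds (tail ρ))) (r₁ a b d (+ head ρ) (dot ds (tail ρ)))
  dot-combine a (c ∷ cs) b []       ρ =
    trans (cong (ℤ._+_ (a ℤ.* c ℤ.* + head ρ)) (dot-combine a cs b [] (tail ρ))) (r₂ a b c (+ head ρ) (dot cs (tail ρ)))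
  dot-combine a (c ∷ cs) b (d ∷ ds) ρ =
    trans (cong (ℤ._+_ ((a ℤ.* c ℤ.+ b ℤ.* d) ℤ.* + head ρ)) (dot-combine a cs b ds (tail ρ)))
      (r₃ a b c d (+ head ρ) (dot cs (tail ρ)) (dot ds (tail ρ)))

  value-combine : ∀ a r b s ρ →
    value (combineRow a r b s) ρ ≡ a ℤ.* value r ρ ℤ.+ b ℤ.* value s ρ
  value-combine a (k ⊹ cs) b (l ⊹ ds) ρ =
    trans (cong (ℤ._+_ (a ℤ.* k ℤ.+ b ℤ.* l)) (dot-combine a cs b ds ρ))
      (r₄ a k (dot cs ρ) b l (dot ds ρ))

  unit : ℕ → List ℤ
  unit zero    = + 1 ∷ []
  unit (suc i) = + 0 ∷ unit i

  row : Exp → Row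
  row (var i)  = + 0 ⊹ unit i
  row (lit k)  = + k ⊹ []
  row (a :+ b) = combineRow (+ 1) (row a) (+ 1) (row b)
  row (k :* a) = combineRow (+ k) (row a) (+ 0) (+ 0 ⊹ [])

  dot-unit : ∀ i ρ → dot (unit i) ρ ≡ + lookup ρ i
  dot-unit zero    ρ = trans (ℤP.+-identityʳ _) (ℤP.*-identityˡ _)
  dot-unit (suc i) ρ = trans (ℤP.+-identityˡ _) (dot-unit i (tail ρ))

  value-row : ∀ e ρ → value (row e) ρ ≡ + ⟦ e ⟧ᵉ ρ
  value-row (var i)  ρ = trans (ℤP.+-identityˡ _) (dot-unit i ρ)
  value-row (lit k)  ρ = ℤP.+-identityʳ _
  value-row (a :+ b) ρ = begin
    value (combineRow (+ 1) (row a) (+ 1) (row b)) ρ  ≡⟨ value-combine (+ 1) (row a) (+ 1) (row b) ρ ⟩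
    + 1 ℤ.* value (row a) ρ ℤ.+ + 1 ℤ.* value (row b) ρ
      ≡⟨ cong₂ ℤ._+_ (ℤP.*-identityˡ (value (row a) ρ)) (ℤP.*-identityˡ (value (row b) ρ)) ⟩
    value (row a) ρ ℤ.+ value (row b) ρ  ≡⟨ cong₂ ℤ._+_ (value-row a ρ) (value-row b ρ) ⟩
    + (⟦ a ⟧ᵉ ρ + ⟦ b ⟧ᵉ ρ)  ∎
    where open ≡-Reasoning
  value-row (k :* a) ρ = begin
    value (combineRow (+ k) (row a) (+ 0) (+ 0 ⊹ [])) ρ  ≡⟨ value-combine (+ k) (row a) (+ 0) (+ 0 ⊹ []) ρ ⟩
    + k ℤ.* value (row a) ρ ℤ.+ + 0  ≡⟨ ℤP.+-identityʳ _ ⟩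
    + k ℤ.* value (row a) ρ  ≡⟨ cong (+ k ℤ.*_) (value-row a ρ) ⟩
    + k ℤ.* + ⟦ a ⟧ᵉ ρ  ≡⟨ ℤP.pos-* k (⟦ a ⟧ᵉ ρ) ⟨
    + (k * ⟦ a ⟧ᵉ ρ)  ∎
    where open ≡-Reasoning

  Null NonNeg : Row → Env → Set
  Null   r ρ = value r ρ ≡ + 0
  NonNeg r ρ = + 0 ℤ.≤ value r ρ

  difference : Exp → Exp → Row
  difference a b = combineRow (+ 1) (row b) (-[1+ 0 ]) (row a)

  value-difference : ∀ a b ρ →
    value (difference a b) ρ ≡ + ⟦ b ⟧ᵉ ρ ℤ.- + ⟦ a ⟧ᵉ ρ
  value-difference a b ρ = begin
    value (difference a b) ρ  ≡⟨ value-combine (+ 1) (row b) (-[1+ 0 ]) (row a) ρ ⟩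
    + 1 ℤ.* value (row b) ρ ℤ.+ -[1+ 0 ] ℤ.* value (row a) ρ
      ≡⟨ cong₂ ℤ._+_ (ℤP.*-identityˡ (value (row b) ρ)) (ℤP.-1*i≡-i (value (row a) ρ)) ⟩
    value (row b) ρ ℤ.- value (row a) ρ  ≡⟨ cong₂ ℤ._-_ (value-row b ρ) (value-row a ρ) ⟩
    + ⟦ b ⟧ᵉ ρ ℤ.- + ⟦ a ⟧ᵉ ρ  ∎
    where open ≡-Reasoning

  difference-nonNeg : ∀ a b ρ → ⟦ a ⟧ᵉ ρ ≤ ⟦ b ⟧ᵉ ρ → NonNeg (difference a b) ρ
  difference-nonNeg a b ρ p =
    subst (+ 0 ℤ.≤_) (sym (value-difference a b ρ)) (ℤP.i≤j⇒0≤j-i (ℤ.+≤+ p))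

  difference-null : ∀ a b ρ → ⟦ a ⟧ᵉ ρ ≡ ⟦ b ⟧ᵉ ρ → Null (difference a b) ρ
  difference-null a b ρ p =
    trans (value-difference a b ρ) (ℤP.i≡j⇒i-j≡0 (cong +_ (sym p)))

  combine-null : ∀ a r b s ρ → Null r ρ → Null s ρ → Null (combineRow a r b s) ρ
  combine-null a r b s ρ p q = trans (value-combine a r b s ρ)
    (cong₂ ℤ._+_ (trans (cong (a ℤ.*_) p) (ℤP.*-zeroʳ a)) (trans (cong (b ℤ.*_) q) (ℤP.*-zeroʳ b)))

  scale-nonNeg : ∀ n i → + 0 ℤ.≤ i → + 0 ℤ.≤ + n ℤ.* i
  scale-nonNeg n i p = subst (ℤ._≤ + n ℤ.* i) (ℤP.*-zeroʳ (+ n)) (ℤP.*-monoˡ-≤-nonNeg (+ n) p)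

  combine-nonNeg : ∀ a r b s ρ → NonNeg r ρ → NonNeg s ρ → NonNeg (combineRow (+ a) r (+ b) s) ρ
  combine-nonNeg a r b s ρ p q =
    subst (+ 0 ℤ.≤_) (sym (value-combine (+ a) r (+ b) s ρ))
      (ℤP.+-mono-≤ (scale-nonNeg a _ p) (scale-nonNeg b _ q))

  combine-nonNeg-null : ∀ a r b s ρ → NonNeg r ρ → Null s ρ → NonNeg (combineRow (+ a) r b s) ρ
  combine-nonNeg-null a r b s ρ p q =
    subst (+ 0 ℤ.≤_) (sym (trans (value-combine (+ a) r b s ρ)
      (trans (cong (ℤ._+_ (+ a ℤ.* value r ρ)) (trans (cong (b ℤ.*_) q) (ℤP.*-zeroʳ b))) (ℤP.+-identityʳ _))))
      (scale-nonNeg a _ p)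

  pivot : Row → ℤ
  pivot (_ ⊹ [])    = + 0
  pivot (_ ⊹ c ∷ _) = c

  -- A row that mentions the leading variable is discarded.
  shrink : Row → List Row
  shrink (k ⊹ [])             = (k ⊹ []) ∷ []
  shrink (k ⊹ + 0 ∷ cs)       = (k ⊹ cs) ∷ []
  shrink (k ⊹ + (suc _) ∷ cs) = []
  shrink (k ⊹ -[1+ _ ] ∷ cs)  = []

  shrink⁺ : ∀ (P : ℤ → Set) r ρ → P (value r ρ) → All (λ s → P (value s (tail ρ))) (shrink r)
  shrink⁺ P (k ⊹ [])             ρ p = p ∷ []
  shrink⁺ P (k ⊹ + 0 ∷ cs)       ρ p = subst P (cong (ℤ._+_ k) (ℤP.+-identityˡ (dot cs (tail ρ)))) p ∷ []
  shrink⁺ P (k ⊹ + (suc _) ∷ cs) ρ p = []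
  shrink⁺ P (k ⊹ -[1+ _ ] ∷ cs)  ρ p = []

  data Sign : Set where neg zer pos : Sign

  sign : ℤ → Sign
  sign (+ 0)       = zer
  sign (+ (suc _)) = pos
  sign -[1+ _ ]    = neg

  select : Sign → List Row → List Row
  select s []       = []
  select s (r ∷ rs) with s | sign (pivot r)
  ... | neg | neg = r ∷ select neg rs
  ... | zer | zer = r ∷ select zer rs
  ... | pos | pos = r ∷ select pos rs
  ... | t   | _   = select t rs

  select⁺ : ∀ {P : Row → Set} s rs → All P rs → All P (select s rs)
  select⁺ s []       []       = []
  select⁺ s (r ∷ rs) (p ∷ ps) with s | sign (pivot r)
  ... | neg | neg = p ∷ select⁺ neg rs ps
  ... | zer | zer = p ∷ select⁺ zer rs ps
  ... | pos | pos = p ∷ select⁺ pos rs ps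
  ... | neg | zer = select⁺ neg rs ps
  ... | neg | pos = select⁺ neg rs ps
  ... | zer | neg = select⁺ zer rs ps
  ... | zer | pos = select⁺ zer rs ps
  ... | pos | neg = select⁺ pos rs ps
  ... | pos | zer = select⁺ pos rs ps

  allNonNeg allNonPos : List ℤ → Bool
  allNonNeg []              = true
  allNonNeg (+ _ ∷ cs)      = allNonNeg cs
  allNonNeg (-[1+ _ ] ∷ cs) = false
  allNonPos []              = true
  allNonPos (+ 0 ∷ cs)      = allNonPos cs
  allNonPos (+ suc _ ∷ cs)  = false
  allNonPos (-[1+ _ ] ∷ cs) = allNonPos cs

  -- Variables range over ℕ, so such a row cannot be nonnegative.
  absurd : Row → Bool
  absurd (+ _ ⊹ _)       = false
  absurd (-[1+ _ ] ⊹ cs) = allNonPos cs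

  dot-nonPos : ∀ cs ρ → allNonPos cs ≡ true → dot cs ρ ℤ.≤ + 0
  dot-nonPos []              ρ p = ℤP.≤-refl
  dot-nonPos (+ 0 ∷ cs)      ρ p =
    subst (ℤ._≤ + 0) (sym (ℤP.+-identityˡ (dot cs (tail ρ)))) (dot-nonPos cs (tail ρ) p)
  dot-nonPos (-[1+ n ] ∷ cs) ρ p = ℤP.+-mono-≤
    (subst (ℤ._≤ + 0) (ℤP.*-comm (+ head ρ) -[1+ n ])
      (subst (+ head ρ ℤ.* -[1+ n ] ℤ.≤_) (ℤP.*-zeroʳ (+ head ρ))
        (ℤP.*-monoˡ-≤-nonNeg (+ head ρ) (ℤ.-≤+ {n} {0}))))
    (dot-nonPos cs (tail ρ) p)

  absurd-sound : ∀ r ρ → absurd r ≡ true → NonNeg r ρ → ⊥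
  absurd-sound (-[1+ n ] ⊹ cs) ρ p q =
    ℤP.<⇒≱ ℤ.-<+ (ℤP.≤-trans q (ℤP.+-mono-≤ (ℤP.≤-refl { -[1+ n ]}) (dot-nonPos cs ρ p)))

  anyAbsurd : List Row → Bool
  anyAbsurd []       = false
  anyAbsurd (r ∷ rs) = absurd r ∨ anyAbsurd rs

  anyAbsurd-sound : ∀ rs ρ → anyAbsurd rs ≡ true → All (λ r → NonNeg r ρ) rs → ⊥
  anyAbsurd-sound (r ∷ rs) ρ p (q ∷ qs) with absurd r in eq
  ... | true  = absurd-sound r ρ eq q
  ... | false = anyAbsurd-sound rs ρ p qs

  -- Such a row holds for all values in ℕ. Dropping it limits the growth caused by `cross`.
  trivial : Row → Bool
  trivial (+ _ ⊹ cs)      = allNonNeg cs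
  trivial (-[1+ _ ] ⊹ cs) = false

  prune : List Row → List Row
  prune []       = []
  prune (r ∷ rs) = if trivial r then prune rs else r ∷ prune rs

  prune⁺ : ∀ {P : Row → Set} rs → All P rs → All P (prune rs)
  prune⁺ []       []       = []
  prune⁺ (r ∷ rs) (p ∷ ps) with trivial r
  ... | true  = prune⁺ rs ps
  ... | false = p ∷ prune⁺ rs ps

  concatMap⁺ : ∀ {A B : Set} {P : A → Set} {Q : B → Set} (f : A → List B) {xs} →
    (∀ x → P x → All Q (f x)) → All P xs → All Q (List.concatMap f xs)
  concatMap⁺ f g []       = []
  concatMap⁺ f g (p ∷ ps) = ++⁺ (g _ p) (concatMap⁺ f g ps)

  -- Gaussian elimination: the equation `e` may be added with any coefficient, but an inequality `r`
  -- may be scaled only by a nonnegative number, hence the split on the sign of the pivot.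
  substitute : Row → Row → List Row
  substitute e r with pivot e
  ... | + n      = shrink (combineRow (+ n) r (ℤ.- pivot r) e)
  ... | -[1+ n ] = shrink (combineRow (+ suc n) r (pivot r) e)

  cross : List Row → List Row → List Row
  cross ps ns = List.concatMap (λ p → List.concatMap (λ n →
    shrink (combineRow (+ ℤ.∣ pivot n ∣) p (+ ℤ.∣ pivot p ∣) n)) ns) ps

  findPivot : List Row → Maybe Row
  findPivot []       = nothing
  findPivot (e ∷ es) with sign (pivot e)
  ... | zer = findPivot es
  ... | _   = just e

  findPivot⁺ : ∀ {P : Row → Set} es {e} → All P es → findPivot es ≡ just e → P e
  findPivot⁺ (e ∷ es) (p ∷ ps) eq with sign (pivot e)
  findPivot⁺ (e ∷ es) (p ∷ ps) refl | neg = p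
  findPivot⁺ (e ∷ es) (p ∷ ps) refl | pos = p
  findPivot⁺ (e ∷ es) (p ∷ ps) eq   | zer = findPivot⁺ es ps eq

  substitute-null : ∀ e r ρ → Null e ρ → Null r ρ → All (λ s → Null s (tail ρ)) (substitute e r)
  substitute-null e r ρ p q with pivot e
  ... | + n      = shrink⁺ (_≡ + 0) _ ρ (combine-null (+ n) r (ℤ.- pivot r) e ρ q p)
  ... | -[1+ n ] = shrink⁺ (_≡ + 0) _ ρ (combine-null (+ suc n) r (pivot r) e ρ q p)

  substitute-nonNeg : ∀ e r ρ → Null e ρ → NonNeg r ρ → All (λ s → NonNeg s (tail ρ)) (substitute e r)
  substitute-nonNeg e r ρ p q with pivot e
  ... | + n      = shrink⁺ (+ 0 ℤ.≤_) _ ρ (combine-nonNeg-null n r (ℤ.- pivot r) e ρ q p)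
  ... | -[1+ n ] = shrink⁺ (+ 0 ℤ.≤_) _ ρ (combine-nonNeg-null (suc n) r (pivot r) e ρ q p)

  -- The variable about to be eliminated ranges over ℕ; this supplies its lower bound 0.
  headRow : Row
  headRow = + 0 ⊹ + 1 ∷ []

  headRow-nonNeg : ∀ ρ → NonNeg headRow ρ
  headRow-nonNeg ρ = subst (+ 0 ℤ.≤_)
    (sym (trans (ℤP.+-identityˡ (+ 1 ℤ.* + head ρ ℤ.+ + 0)) (trans (ℤP.+-identityʳ _) (ℤP.*-identityˡ (+ head ρ))))) (ℤ.+≤+ ℕ.z≤n)

  -- `anyAbsurd` sees inequalities only, so a remaining equation r = 0 is handed over as r ≥ 0 and -
  -- r ≥ 0.
  nullRows : List Row → List Row
  nullRows = List.concatMap (λ r → r ∷ combineRow -[1+ 0 ] r (+ 0) (+ 0 ⊹ []) ∷ [])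

  -- Fourier–Motzkin elimination of the first m variables; false does not mean feasible.
  infeasible : ℕ → List Row → List Row → Bool
  infeasible zero    es rs = anyAbsurd (nullRows es ++ rs)
  infeasible (suc m) es rs with anyAbsurd rs
  ... | true  = true
  ... | false with findPivot es
  ... | just e  = infeasible m (List.concatMap (substitute e) es)
                               (prune (List.concatMap (substitute e) (headRow ∷ rs)))
  ... | nothing = infeasible m (List.concatMap shrink es)
                               (prune (List.concatMap shrink (select zer rs) ++
                                       cross (headRow ∷ select pos rs) (select neg rs)))

  nullRows⁺ : ∀ es ρ → All (λ e → Null e ρ) es → All (λ e → NonNeg e ρ) (nullRows es)
  nullRows⁺ es ρ = concatMap⁺ _ λ r p →
    ℤP.≤-reflexive (sym p) ∷
    ℤP.≤-reflexive (sym (combine-null -[1+ 0 ] r (+ 0) (+ 0 ⊹ []) ρ p refl)) ∷ []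

  infeasible-sound : ∀ m es rs ρ → infeasible m es rs ≡ true →
    All (λ e → Null e ρ) es → All (λ r → NonNeg r ρ) rs → ⊥
  infeasible-sound zero    es rs ρ eq ps qs = anyAbsurd-sound _ ρ eq (++⁺ (nullRows⁺ es ρ ps) qs)
  infeasible-sound (suc m) es rs ρ eq ps qs with anyAbsurd rs in eq₁
  ... | true  = anyAbsurd-sound rs ρ eq₁ qs
  ... | false with findPivot es in eq₂
  ... | just e  = infeasible-sound m _ _ (tail ρ) eq
        (concatMap⁺ _ (λ r → substitute-null e r ρ p) ps)
        (prune⁺ _ (concatMap⁺ _ (λ r → substitute-nonNeg e r ρ p) (headRow-nonNeg ρ ∷ qs)))
        where p = findPivot⁺ es ps eq₂
  ... | nothing = infeasible-sound m _ _ (tail ρ) eq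
        (concatMap⁺ _ (λ r → shrink⁺ (_≡ + 0) r ρ) ps)
        (prune⁺ _ (++⁺ (concatMap⁺ _ (λ r → shrink⁺ (+ 0 ℤ.≤_) r ρ) (select⁺ zer rs qs))
          (concatMap⁺ _ (λ r p → concatMap⁺ _ (λ s q →
              shrink⁺ (+ 0 ℤ.≤_) _ ρ (combine-nonNeg ℤ.∣ pivot s ∣ r ℤ.∣ pivot r ∣ s ρ p q))
            (select⁺ neg rs qs)) (headRow-nonNeg ρ ∷ select⁺ pos rs qs))))

  -- Case analysis over the disjunctions of φ, cutting infeasible branches early.
  search : ℕ → Formula → List Row → List Row → (List Row → List Row → Bool) → Bool
  search m (a :≤ b) es rs k = k es (difference a b ∷ rs)
  search m (a :≡ b) es rs k = k (difference a b ∷ es) rs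
  search m (φ :∧ ψ) es rs k = search m φ es rs λ es′ rs′ → search m ψ es′ rs′ k
  search m (φ :∨ ψ) es rs k with infeasible m es rs
  ... | true  = true
  ... | false = search m φ es rs k ∧ search m ψ es rs k
  search m :⊥ es rs k = true
  search m :⊤ es rs k = k es rs

  ∧-true : ∀ a b → a ∧ b ≡ true → a ≡ true × b ≡ true
  ∧-true true true _ = refl , refl

  search-sound : ∀ m φ es rs k ρ → search m φ es rs k ≡ true →
    All (λ e → Null e ρ) es → All (λ r → NonNeg r ρ) rs →
    (∀ es′ rs′ → k es′ rs′ ≡ true → All (λ e → Null e ρ) es′ → All (λ r → NonNeg r ρ) rs′ → ⊥) →
    ⟦ φ ⟧ ρ → ⊥
  search-sound m (a :≤ b) es rs k ρ eq ps qs c h =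
    c _ _ eq ps (difference-nonNeg a b ρ h ∷ qs)
  search-sound m (a :≡ b) es rs k ρ eq ps qs c h =
    c _ _ eq (difference-null a b ρ h ∷ ps) qs
  search-sound m (φ :∧ ψ) es rs k ρ eq ps qs c (h , h′) =
    search-sound m φ es rs _ ρ eq ps qs
      (λ es′ rs′ eq′ ps′ qs′ → search-sound m ψ es′ rs′ k ρ eq′ ps′ qs′ c h′) h
  search-sound m (φ :∨ ψ) es rs k ρ eq ps qs c h with infeasible m es rs in eq₁
  search-sound m (φ :∨ ψ) es rs k ρ eq ps qs c h        | true  = infeasible-sound m es rs ρ eq₁ ps qs
  search-sound m (φ :∨ ψ) es rs k ρ eq ps qs c (inj₁ h) | false =
    search-sound m φ es rs k ρ (proj₁ (∧-true _ _ eq)) ps qs c h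
  search-sound m (φ :∨ ψ) es rs k ρ eq ps qs c (inj₂ h) | false =
    search-sound m ψ es rs k ρ (proj₂ (∧-true (search m φ es rs k) _ eq)) ps qs c h
  search-sound m :⊤ es rs k ρ eq ps qs c h = c _ _ eq ps qs

  entails : ℕ → Formula → Formula → Bool
  entails m φ ψ = search m (φ :∧ negate ψ) [] [] (infeasible m)

  entails-sound : ∀ m φ ψ ρ → entails m φ ψ ≡ true → ⟦ φ ⟧ ρ → ⟦ ψ ⟧ ρ
  entails-sound m φ ψ ρ eq h with decide ψ ρ
  ... | inj₁ p = p
  ... | inj₂ p = ⊥-elim (search-sound m (φ :∧ negate ψ) [] [] (infeasible m) ρ eq [] []
                   (λ es rs eq′ → infeasible-sound m es rs ρ eq′) (h , p))

  infix 4 _:<_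
  _:<_ : Exp → Exp → Formula
  a :< b = lit 1 :+ a :≤ b

  pattern x₀ = var 0
  pattern x₁ = var 1
  pattern x₂ = var 2
  pattern x₃ = var 3
  pattern x₄ = var 4
  pattern x₅ = var 5
  pattern x₆ = var 6

  -- The working form of the procedure: the test runs during type checking, so each use passes
  -- `refl`, and the variables are the entries of `ρ` in order.
  linear : ∀ φ ψ ρ → entails (List.length ρ) φ ψ ≡ true → ⟦ φ ⟧ ρ → ⟦ ψ ⟧ ρ
  linear φ ψ ρ = entails-sound (List.length ρ) φ ψ ρ

-- Sums, cardinalities of subsets, and rotation of ℤ/nℤ

module Counting where

  open import Data.Bool.Base using (Bool; true; false)
  open import Data.Empty using (⊥; ⊥-elim)
  open import Data.Fin.Base using (Fin; zero; suc; toℕ)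
  open import Data.Fin.Properties using (toℕ<n; toℕ-injective; toℕ-fromℕ<)
  open import Data.Fin.Subset using (Subset; _∈_; ∣_∣)
  open import Data.Nat.Base
  open import Data.Nat.DivMod using (_%_; _mod_; m%n<n; [m+n]%n≡m%n; m<n⇒m%n≡m; %-distribˡ-+; m%n%n≡m%n)
  open import Data.Nat.Properties
  open import Algebra.Properties.CommutativeSemigroup +-commutativeSemigroup using (interchange; x∙yz≈y∙xz)
  open import Data.Product.Base using (∃-syntax; _×_; _,_)
  open import Data.Sum.Base as Sum using (_⊎_; inj₁; inj₂)
  open import Data.Vec.Base using ([]; _∷_; lookup; here; there)
  open import Function.Base using (_∘_)
  open import Relation.Binary.PropositionalEquality

  sum : ℕ → (ℕ → ℕ) → ℕ
  sum zero    f = 0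
  sum (suc n) f = f 0 + sum n (f ∘ suc)

  bit : Bool → ℕ
  bit false = 0
  bit true  = 1

  sum-cong : ∀ n {f g : ℕ → ℕ} → (∀ {i} → i < n → f i ≡ g i) → sum n f ≡ sum n g
  sum-cong zero    e = refl
  sum-cong (suc n) e = cong₂ _+_ (e z<s) (sum-cong n (e ∘ s<s))

  sum-mono : ∀ n {f g : ℕ → ℕ} → (∀ {i} → i < n → f i ≤ g i) → sum n f ≤ sum n g
  sum-mono zero    e = z≤n
  sum-mono (suc n) e = +-mono-≤ (e z<s) (sum-mono n (e ∘ s<s))

  sum-const : ∀ n c → sum n (λ _ → c) ≡ n * c
  sum-const zero    c = refl
  sum-const (suc n) c = cong (c +_) (sum-const n c)

  sum-split : ∀ m n (f : ℕ → ℕ) → sum (m + n) f ≡ sum m f + sum n (f ∘ (m +_))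
  sum-split zero    n f = refl
  sum-split (suc m) n f = trans (cong (f 0 +_) (sum-split m n (f ∘ suc))) (sym (+-assoc (f 0) _ _))

  sum-distrib : ∀ n (f g : ℕ → ℕ) → sum n (λ i → f i + g i) ≡ sum n f + sum n g
  sum-distrib zero    f g = refl
  sum-distrib (suc n) f g = trans (cong (f 0 + g 0 +_) (sum-distrib n (f ∘ suc) (g ∘ suc)))
    (interchange (f 0) (g 0) _ _)

  sum-last : ∀ n (f : ℕ → ℕ) → sum (suc n) f ≡ sum n f + f n
  sum-last zero    f = +-comm (f 0) 0
  sum-last (suc n) f = trans (cong (f 0 +_) (sum-last n (f ∘ suc))) (sym (+-assoc (f 0) _ _))

  -- The sum over the n + 1 arguments from x on can be split off at either end; periodicity equates
  -- the two end terms, so moving the window by one changes nothing.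
  sum-rotate : ∀ n (f : ℕ → ℕ) → (∀ i → f (i + n) ≡ f i) → ∀ x → sum n (λ i → f (x + i)) ≡ sum n f
  sum-rotate n f periodic zero    = refl
  sum-rotate n f periodic (suc x) = trans (+-cancelˡ-≡ (f x) _ _ (begin
    f x + sum n (λ i → f (suc x + i))        ≡⟨ cong₂ _+_ (cong f (sym (+-identityʳ x))) (sum-cong n λ {i} _ → cong f (sym (+-suc x i))) ⟩
    f (x + 0) + sum n (λ i → f (x + suc i))  ≡⟨ sum-last n (λ i → f (x + i)) ⟩
    sum n (λ i → f (x + i)) + f (x + n)      ≡⟨ +-comm _ (f (x + n)) ⟩
    f (x + n) + sum n (λ i → f (x + i))      ≡⟨ cong (_+ sum n (λ i → f (x + i))) (periodic x) ⟩
    f x + sum n (λ i → f (x + i))            ∎)) (sum-rotate n f periodic x)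
    where open ≡-Reasoning

  card : ∀ {n} (p : Subset n) (f : ℕ → Bool) → (∀ v → lookup p v ≡ f (toℕ v)) → ∣ p ∣ ≡ sum n (bit ∘ f)
  card []          f e = refl
  card (true  ∷ p) f e = cong₂ _+_ (cong bit (e zero)) (card p (f ∘ suc) (e ∘ suc))
  card (false ∷ p) f e = cong₂ _+_ (cong bit (e zero)) (card p (f ∘ suc) (e ∘ suc))

  remove : ∀ {n} {p : Subset n} {x k} → x ∈ p → ∣ p ∣ ≡ suc k →
    ∃[ q ] ∣ q ∣ ≡ k × (∀ {y} → y ∈ q → y ∈ p × y ≢ x)
  remove {p = true ∷ p} here e = false ∷ p , suc-injective e , λ where (there i) → there i , λ ()
  remove {p = false ∷ p} (there i) e with q , e′ , f ← remove i e =
    false ∷ q , e′ , λ where (there j) → let (j′ , ≢) = f j in there j′ , λ where refl → ≢ refl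
  remove {p = true ∷ p} {k = zero} (there {i = x} i) e = ⊥-elim (nonempty i (suc-injective e))
    where
    nonempty : ∀ {n} {p : Subset n} {x} → x ∈ p → ∣ p ∣ ≢ 0
    nonempty here ()
    nonempty {p = false ∷ p} (there i) e = nonempty i e
  remove {p = true ∷ p} {k = suc k} (there i) e with q , e′ , f ← remove i (suc-injective e) =
    true ∷ q , cong suc e′ , λ where
      here      → here , λ ()
      (there j) → let (j′ , ≢) = f j in there j′ , λ where refl → ≢ refl

  pick : ∀ {n} (p : Subset n) {k} → ∣ p ∣ ≡ suc k → ∃[ x ] x ∈ p
  pick (true  ∷ p) e = zero , here
  pick (false ∷ p) e with x , i ← pick p e = suc x , there i

  insertVertex : ∀ {n} (p : Subset n) x → (x ∈ p → ⊥) →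
    ∃[ q ] ∣ q ∣ ≡ suc ∣ p ∣ × (∀ {y} → y ∈ q → y ≡ x ⊎ y ∈ p)
  insertVertex (true  ∷ p) zero ∉ = ⊥-elim (∉ here)
  insertVertex (false ∷ p) zero ∉ = true ∷ p , refl , λ where
    here      → inj₁ refl
    (there i) → inj₂ (there i)
  insertVertex (true ∷ p) (suc x) ∉ with q , e , f ← insertVertex p x (∉ ∘ there) =
    true ∷ q , cong suc e , λ where
      here      → inj₂ here
      (there i) → Sum.map (cong suc) there (f i)
  insertVertex (false ∷ p) (suc x) ∉ with q , e , f ← insertVertex p x (∉ ∘ there) =
    false ∷ q , e , λ where (there i) → Sum.map (cong suc) there (f i)

  module Cyclic (n : ℕ) .{{_ : NonZero n}} where

    opaque
      at : Fin n → ℕ → Fin n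
      at x w = (toℕ x + w) mod n

      toℕ-at : ∀ x w → toℕ (at x w) ≡ (toℕ x + w) % n
      toℕ-at x w = toℕ-fromℕ< (m%n<n (toℕ x + w) n)

    at-at : ∀ x v w → at (at x v) w ≡ at x (v + w)
    at-at x v w = toℕ-injective (begin
      toℕ (at (at x v) w)              ≡⟨ toℕ-at (at x v) w ⟩
      (toℕ (at x v) + w) % n           ≡⟨ cong (λ a → (a + w) % n) (toℕ-at x v) ⟩
      ((toℕ x + v) % n + w) % n        ≡⟨ %-distribˡ-+ ((toℕ x + v) % n) w n ⟩
      ((toℕ x + v) % n % n + w % n) % n ≡⟨ cong (λ a → (a + w % n) % n) (m%n%n≡m%n (toℕ x + v) n) ⟩
      ((toℕ x + v) % n + w % n) % n    ≡⟨ %-distribˡ-+ (toℕ x + v) w n ⟨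
      (toℕ x + v + w) % n              ≡⟨ cong (_% n) (+-assoc (toℕ x) v w) ⟩
      (toℕ x + (v + w)) % n            ≡⟨ toℕ-at x (v + w) ⟨
      toℕ (at x (v + w))               ∎)
      where open ≡-Reasoning

    at-+n : ∀ x w → at x (w + n) ≡ at x w
    at-+n x w = toℕ-injective (begin
      toℕ (at x (w + n))       ≡⟨ toℕ-at x (w + n) ⟩
      (toℕ x + (w + n)) % n    ≡⟨ cong (_% n) (+-assoc (toℕ x) w n) ⟨
      (toℕ x + w + n) % n      ≡⟨ [m+n]%n≡m%n (toℕ x + w) n ⟩
      (toℕ x + w) % n          ≡⟨ toℕ-at x w ⟨
      toℕ (at x w)             ∎)
      where open ≡-Reasoning

    at-shift : ∀ x {w} → w < n → toℕ x + w ≡ toℕ (at x w) ⊎ toℕ x + w ≡ toℕ (at x w) + n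
    at-shift x {w} w<n with ≤-<-connex n (toℕ x + w)
    ... | inj₂ m<n = inj₁ (sym (trans (toℕ-at x w) (m<n⇒m%n≡m m<n)))
    ... | inj₁ n≤m = inj₂ (begin
      toℕ x + w                         ≡⟨ m∸n+n≡m n≤m ⟨
      toℕ x + w ∸ n + n                 ≡⟨ cong (_+ n) (m<n⇒m%n≡m m∸n<n) ⟨
      (toℕ x + w ∸ n) % n + n           ≡⟨ cong (_+ n) ([m+n]%n≡m%n (toℕ x + w ∸ n) n) ⟨
      (toℕ x + w ∸ n + n) % n + n       ≡⟨ cong (λ a → a % n + n) (m∸n+n≡m n≤m) ⟩
      (toℕ x + w) % n + n               ≡⟨ cong (_+ n) (toℕ-at x w) ⟨
      toℕ (at x w) + n                  ∎)
      where
      open ≡-Reasoning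
      m∸n<n : toℕ x + w ∸ n < n
      m∸n<n = +-cancelʳ-< n _ _ (subst (_< n + n) (sym (m∸n+n≡m n≤m)) (+-mono-< (toℕ<n x) w<n))

    at-0 : ∀ x → at x 0 ≡ x
    at-0 x = toℕ-injective (trans (toℕ-at x 0)
      (trans (cong (_% n) (+-identityʳ (toℕ x))) (m<n⇒m%n≡m (toℕ<n x))))

    -- This is y - x modulo n, built just like `residue`, so that the two agree by `toℕ-at`.
    offset : Fin n → Fin n → ℕ
    offset x y = toℕ (at y (n ∸ toℕ x))

    offset< : ∀ x y → offset x y < n
    offset< x y = toℕ<n (at y (n ∸ toℕ x))

    offset-at : ∀ x {w} → w < n → offset x (at x w) ≡ w
    offset-at x {w} p = begin
      toℕ (at (at x w) (n ∸ a))  ≡⟨ cong toℕ (at-at x w (n ∸ a)) ⟩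
      toℕ (at x (w + (n ∸ a)))   ≡⟨ toℕ-at x (w + (n ∸ a)) ⟩
      (a + (w + (n ∸ a))) % n    ≡⟨ cong (_% n) (x∙yz≈y∙xz a w (n ∸ a)) ⟩
      (w + (a + (n ∸ a))) % n    ≡⟨ cong (λ b → (w + b) % n) (m+[n∸m]≡n (<⇒≤ (toℕ<n x))) ⟩
      (w + n) % n                ≡⟨ [m+n]%n≡m%n w n ⟩
      w % n                      ≡⟨ m<n⇒m%n≡m p ⟩
      w                          ∎
      where
      open ≡-Reasoning
      a = toℕ x

    at-offset : ∀ x y → at x (offset x y) ≡ y
    at-offset x y = toℕ-injective (begin
      toℕ (at x (offset x y))      ≡⟨ toℕ-at x (offset x y) ⟩
      (a + offset x y) % n         ≡⟨ cong (_% n) (+-comm a (offset x y)) ⟩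
      (offset x y + a) % n         ≡⟨ toℕ-at (at y (n ∸ a)) a ⟨
      toℕ (at (at y (n ∸ a)) a)    ≡⟨ cong toℕ (at-at y (n ∸ a) a) ⟩
      toℕ (at y (n ∸ a + a))       ≡⟨ cong (λ b → toℕ (at y b)) (m∸n+n≡m (<⇒≤ (toℕ<n x))) ⟩
      toℕ (at y n)                 ≡⟨ cong toℕ (at-+n y 0) ⟩
      toℕ (at y 0)                 ≡⟨ cong toℕ (at-0 y) ⟩
      toℕ y                        ∎)
      where
      open ≡-Reasoning
      a = toℕ x

    offset-positive : ∀ {x y} → x ≢ y → 0 < offset x y
    offset-positive {x} {y} x≢y = n≢0⇒n>0 λ e →
      x≢y (trans (sym (at-0 x)) (trans (cong (at x) (sym e)) (at-offset x y)))

    opaque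
      unfolding at

      -- Counting may start at any vertex, since the indicator of p extends periodically. This is
      -- what allows an arbitrary x to be treated as 0.
      card-at : ∀ (p : Subset n) x → ∣ p ∣ ≡ sum n (λ w → bit (lookup p (at x w)))
      card-at p x = begin
        ∣ p ∣                                        ≡⟨ card p (λ i → lookup p (i mod n)) (λ v → cong (lookup p) (sym (mod-toℕ v))) ⟩
        sum n (λ i → bit (lookup p (i mod n)))       ≡⟨ sum-rotate n _ (λ i → cong (bit ∘ lookup p) (mod-periodic i)) (toℕ x) ⟨
        sum n (λ w → bit (lookup p (at x w)))        ∎
        where
        open ≡-Reasoning
        toℕ-mod : ∀ i → toℕ (i mod n) ≡ i % n
        toℕ-mod i = toℕ-fromℕ< (m%n<n i n)
        mod-toℕ : ∀ v → toℕ v mod n ≡ v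
        mod-toℕ v = toℕ-injective (trans (toℕ-mod (toℕ v)) (m<n⇒m%n≡m (toℕ<n v)))
        mod-periodic : ∀ i → (i + n) mod n ≡ i mod n
        mod-periodic i = toℕ-injective (trans (toℕ-mod (i + n)) (trans ([m+n]%n≡m%n i n) (sym (toℕ-mod i))))

-- The connection set C in terms of h: sum-freeness, rotation, common neighbours

module Connections where

  open import Data.Bool.Base using (Bool; true; _∧_)
  open import Data.Empty using (⊥; ⊥-elim)
  open import Data.List.Base using (List; []; _∷_)
  open import Data.Nat.Base
  open import Data.Nat.Properties
  open import Data.Product.Base using (∃-syntax; _×_; _,_)
  open import Data.Sum.Base as Sum using (_⊎_; inj₁; inj₂; swap)
  open import Relation.Binary.PropositionalEquality
  open import Relation.Nullary using (¬_)
  open LinearArithmetic hiding (lookup; absurd; head; tail)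

  hᵉ qᵉ nᵉ : Exp → Exp
  hᵉ g = lit 7 :+ g
  qᵉ g = lit 1 :+ 2 :* hᵉ g
  nᵉ g = lit 5 :+ 10 :* hᵉ g

  -- In terms of h, S is {2 h - 1 , 2 h} ∪ [2 h + 4 , 3 h] ∪ {3 h + 2 , 2 q}; the last four
  -- disjuncts are n - S. Everything is stated additively because `Exp` has no subtraction.
  link edge : Exp → Exp → Exp → Formula
  link g a b = (a :+ 2 :* hᵉ g :≤ lit 1 :+ b :∧ b :≤ a :+ 2 :* hᵉ g)
            :∨ (a :+ (lit 4 :+ 2 :* hᵉ g) :≤ b :∧ b :≤ a :+ 3 :* hᵉ g)
            :∨ b :≡ a :+ (lit 2 :+ 3 :* hᵉ g)
            :∨ b :≡ a :+ 2 :* qᵉ g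
            :∨ b :≡ a :+ 3 :* qᵉ g
            :∨ b :≡ a :+ (lit 3 :+ 7 :* hᵉ g)
            :∨ (a :+ (lit 5 :+ 7 :* hᵉ g) :≤ b :∧ b :≤ a :+ (lit 1 :+ 8 :* hᵉ g))
            :∨ (a :+ (lit 5 :+ 8 :* hᵉ g) :≤ b :∧ b :≤ a :+ (lit 6 :+ 8 :* hᵉ g))
  edge g a b = link g a b :∨ link g b a

  shift : Exp → Exp → Exp → Exp → Formula
  shift g x w y = (x :+ w :≡ y :∨ x :+ w :≡ y :+ nᵉ g) :∧ (y :< nᵉ g :∧ w :< nᵉ g)

  -- t = 2 h + 3, q = t - 2 and n = 5 q, with h = 7 + g.
  module Arithmetic (g : ℕ) where

    h q n : ℕ
    h = 7 + g
    q = 1 + 2 * h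
    n = 5 + 10 * h

    -- Says that b - a ∈ S ∪ (n - S), for 0 ≤ a , b < n.
    Link : ℕ → ℕ → Set
    Link a b = ⟦ link x₂ x₀ x₁ ⟧ (a ∷ b ∷ g ∷ [])

    Edge : ℕ → ℕ → Set
    Edge a b = Link a b ⊎ Link b a

    -- Says that y ≡ x + w modulo n.
    Shift : ℕ → ℕ → ℕ → Set
    Shift x w y = (x + w ≡ y ⊎ x + w ≡ y + n) × (y < n × w < n)

    pattern l₁ p = inj₁ p
    pattern l₂ p = inj₂ (inj₁ p)
    pattern l₃ p = inj₂ (l₂ p)
    pattern l₄ p = inj₂ (l₃ p)
    pattern l₅ p = inj₂ (l₄ p)
    pattern l₆ p = inj₂ (l₅ p)
    pattern l₇ p = inj₂ (l₆ p)
    pattern l₈ p = inj₂ (inj₂ (inj₂ (inj₂ (inj₂ (inj₂ (inj₂ p))))))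

    link⇒< : ∀ {a b} → Link a b → a < b
    link⇒< {a} {b} = linear (link x₂ x₀ x₁) (x₀ :< x₁) (a ∷ b ∷ g ∷ []) refl

    link-complement : ∀ {d r} → d + r ≡ n → Link 0 d → Link 0 r
    link-complement {d} {r} e l = linear (x₀ :+ x₁ :≡ nᵉ x₂ :∧ link x₂ (lit 0) x₀) (link x₂ (lit 0) x₁)
      (d ∷ r ∷ g ∷ []) refl (e , l)

    no-triangle-ordered : ∀ {a b c} → Link a b → Link b c → Link a c → ⊥
    no-triangle-ordered {a} {b} {c} k l m = linear (link x₃ x₀ x₁ :∧ link x₃ x₁ x₂ :∧ link x₃ x₀ x₂) :⊥
      (a ∷ b ∷ c ∷ g ∷ []) refl (k , l , m)

    -- Two of the eight orientations are cyclic and contradict `link⇒<`; the other six are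
    -- transitive and reduce to the ordered case after sorting the corners.
    no-triangle : ∀ {a b c} → Edge a b → Edge b c → Edge a c → ⊥
    no-triangle (inj₁ k) (inj₁ l) (inj₁ m) = no-triangle-ordered k l m
    no-triangle (inj₁ k) (inj₁ l) (inj₂ m) = <-asym (<-trans (link⇒< k) (link⇒< l)) (link⇒< m)
    no-triangle (inj₁ k) (inj₂ l) (inj₁ m) = no-triangle-ordered m l k
    no-triangle (inj₁ k) (inj₂ l) (inj₂ m) = no-triangle-ordered m k l
    no-triangle (inj₂ k) (inj₁ l) (inj₁ m) = no-triangle-ordered k m l
    no-triangle (inj₂ k) (inj₁ l) (inj₂ m) = no-triangle-ordered l m k
    no-triangle (inj₂ k) (inj₂ l) (inj₁ m) = <-asym (<-trans (link⇒< l) (link⇒< k)) (link⇒< m)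
    no-triangle (inj₂ k) (inj₂ l) (inj₂ m) = no-triangle-ordered l k m

    -- Adding x may carry only the larger of v and w past n, which turns the difference s into n - s
    -- and reverses the order. The first is absorbed by C = - C, the second by `Edge`.
    link-shift : ∀ {x v w y z} → Shift x v y → Shift x w z → Link v w → Edge y z
    link-shift {x} {v} {w} {y} {z} s s′ l =
      linear (shift x₅ x₀ x₁ x₃ :∧ shift x₅ x₀ x₂ x₄ :∧ link x₅ x₁ x₂) (edge x₅ x₃ x₄)
        (x ∷ v ∷ w ∷ y ∷ z ∷ g ∷ []) refl (s , s′ , l)

    edge-shift : ∀ {x v w y z} → Shift x v y → Shift x w z → Edge v w → Edge y z
    edge-shift s s′ (inj₁ l) = link-shift s s′ l
    edge-shift s s′ (inj₂ l) = swap (link-shift s′ s l)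

    shift-link : ∀ {x v w y z} → Shift x v y → Shift x w z → Link y z → Edge v w
    shift-link {x} {v} {w} {y} {z} s s′ l =
      linear (shift x₅ x₀ x₁ x₃ :∧ shift x₅ x₀ x₂ x₄ :∧ link x₅ x₃ x₄) (edge x₅ x₁ x₂)
        (x ∷ v ∷ w ∷ y ∷ z ∷ g ∷ []) refl (s , s′ , l)

    shift-edge : ∀ {x v w y z} → Shift x v y → Shift x w z → Edge y z → Edge v w
    shift-edge s s′ (inj₁ l) = shift-link s s′ l
    shift-edge s s′ (inj₂ l) = swap (shift-link s′ s l)

    shift-swap : ∀ {x w y v} → x ≢ y → Shift x w y → Shift y v x → w + v ≡ n
    shift-swap {x} {w} {y} {v} x≢y s s′ = Sum.[ (λ e → ⊥-elim (x≢y e)) , (λ e → e) ]′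
      (linear (shift x₄ x₀ x₁ x₂ :∧ shift x₄ x₂ x₃ x₀) (x₀ :≡ x₂ :∨ x₁ :+ x₃ :≡ nᵉ x₄)
        (x ∷ w ∷ y ∷ v ∷ g ∷ []) refl (s , s′))

    common : Exp → Formula
    common c = c :< nᵉ x₁ :∧ edge x₁ (lit 0) c :∧ edge x₁ c x₀

    -- The entry (b , c) asserts that c is adjacent to 0 and w, unless 0 and w are adjacent, for
    -- all w up to b that are beyond the preceding entry.
    covers : Exp → List (Exp × Exp) → Bool
    covers lo []             = entails 2 (lo :< x₀ :∧ x₀ :≤ lit 2 :+ 5 :* hᵉ x₁) :⊥
    covers lo ((hi , c) ∷ t) =
      entails 2 (lo :< x₀ :∧ x₀ :≤ hi) (edge x₁ (lit 0) x₀ :∨ common c) ∧ covers hi t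

    -- With h = 7 + g, the constants 3 + g, 5 + g, 6 + g, 13 + 2 g and 27 + 4 g are h - 4, h - 2, h
    -- - 1, 2 h - 1 and 4 h - 1. Each c lies in C, so only the membership of c - w up to sign limits
    -- its range: c = 3 h, for instance, serves 2 ≤ w ≤ h - 4 because 3 h - w then lies in
    -- [2 h + 4 , 3 h].
    neighbours : List (Exp × Exp)
    neighbours =
        (lit 1                    , 2 :* hᵉ x₁)
      ∷ (lit 3 :+ x₁              , 3 :* hᵉ x₁)
      ∷ (lit 5 :+ x₁              , lit 2 :+ 3 :* hᵉ x₁)
      ∷ (lit 6 :+ x₁              , lit 5 :+ 8 :* hᵉ x₁)
      ∷ (lit 1 :+ hᵉ x₁            , 3 :* hᵉ x₁)
      ∷ (2 :* hᵉ x₁                , 2 :* qᵉ x₁)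
      ∷ (qᵉ x₁                     , 3 :* qᵉ x₁)
      ∷ (3 :* hᵉ x₁                , 2 :* qᵉ x₁)
      ∷ (lit 2 :+ 3 :* hᵉ x₁       , lit 3 :+ 7 :* hᵉ x₁)
      ∷ (lit 27 :+ 4 :* x₁        , 3 :* qᵉ x₁)
      ∷ (4 :* hᵉ x₁                , 2 :* hᵉ x₁)
      ∷ (lit 2 :+ 4 :* hᵉ x₁       , lit 3 :+ 7 :* hᵉ x₁)
      ∷ (lit 4 :+ 4 :* hᵉ x₁       , lit 13 :+ 2 :* x₁)
      ∷ (lit 1 :+ 5 :* hᵉ x₁       , lit 5 :+ 7 :* hᵉ x₁)
      ∷ (lit 2 :+ 5 :* hᵉ x₁       , 2 :* hᵉ x₁)
      ∷ []

    -- Here 2 + 5 h is ⌊n / 2⌋; larger differences are treated by exchanging the two vertices.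
    common-neighbour : ∀ w → 0 < w → w ≤ 2 + 5 * h → ¬ Edge 0 w →
      ∃[ c ] c < n × Edge 0 c × Edge c w
    common-neighbour w 0<w w≤ ¬e = go (lit 0) neighbours refl 0<w
      where
      ρ : Env
      ρ = w ∷ g ∷ []

      go : ∀ lo t → covers lo t ≡ true → ⟦ lo ⟧ᵉ ρ < w → ∃[ c ] c < n × Edge 0 c × Edge c w
      go lo [] eq p = ⊥-elim (entails-sound 2 (lo :< x₀ :∧ x₀ :≤ lit 2 :+ 5 :* hᵉ x₁) :⊥ ρ eq (p , w≤))
      go lo ((hi , c) ∷ t) eq p with ∧-true _ _ eq | ≤-<-connex w (⟦ hi ⟧ᵉ ρ)
      ... | _  , eq | inj₂ p′ = go hi t eq p′
      ... | eq , _  | inj₁ p′ = Sum.[ (λ e → ⊥-elim (¬e e)) , (λ d → ⟦ c ⟧ᵉ ρ , d) ]′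
        (entails-sound 2 (lo :< x₀ :∧ x₀ :≤ hi) (edge x₁ (lit 0) x₀ :∨ common c) ρ eq (p , p′))

-- The automaton that reads the columns

module Columns where

  open import Data.Bool.Base using (T; Bool; true; false; _∧_; _∨_; not; if_then_else_)
  open import Data.Empty using (⊥; ⊥-elim)
  open import Data.Fin.Base using (Fin; zero; suc)
  open import Data.Fin.Patterns
  open import Data.List.Base using (List; []; _∷_; concatMap; foldr; map; filterᵇ)
  open import Data.Bool.ListAction using (any)
  open import Data.List.Relation.Unary.Any using (Any; here; there)
  open import Data.List.Membership.Propositional using (_∈_; find; lose)
  open import Data.List.Membership.Propositional.Properties using (∈-concatMap⁺; ∈-map⁺)
  open import Data.Nat.Base
  open import Data.Nat.Properties
  open import Data.Product.Base using (_×_; _,_; proj₁; proj₂)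
  open import Data.Sum.Base as Sum using (_⊎_; inj₁; inj₂)
  open import Data.Unit.Base using (tt)
  open import Data.Vec.Base using (Vec; []; _∷_; lookup; tabulate)
  open import Data.Vec.Properties using (lookup∘tabulate)
  open import Function.Base using (_∘_)
  open import Relation.Binary.PropositionalEquality
  open LinearArithmetic hiding (lookup; absurd; head; tail)
  open Counting using (bit)

  -- The trace on one coset of qℤ of a set of residues modulo 5q.
  Cell : Set
  Cell = Vec Bool 5

  _!_ : Cell → Fin 5 → Bool
  _!_ = lookup

  infix 4 _⊑_
  infix 5 _⊑ᵇ_
  infixl 6 _∖[_]_

  _⊑ᵇ_ : ∀ {n} → Vec Bool n → Vec Bool n → Bool
  []       ⊑ᵇ []       = true
  (a ∷ as) ⊑ᵇ (b ∷ bs) = (not a ∨ b) ∧ (as ⊑ᵇ bs)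

  lookup-⊑ᵇ : ∀ {n} (u v : Vec Bool n) → u ⊑ᵇ v ≡ true → ∀ k → lookup u k ≡ true → lookup v k ≡ true
  lookup-⊑ᵇ (true  ∷ as) (true ∷ bs) p zero    q = refl
  lookup-⊑ᵇ (true  ∷ as) (true ∷ bs) p (suc k) q = lookup-⊑ᵇ as bs p k q
  lookup-⊑ᵇ (false ∷ as) (b    ∷ bs) p (suc k) q = lookup-⊑ᵇ as bs p k q

  ⊑ᵇ-lookup : ∀ {n} (u v : Vec Bool n) → (∀ k → lookup u k ≡ true → lookup v k ≡ true) → u ⊑ᵇ v ≡ true
  ⊑ᵇ-lookup []           []       p = refl
  ⊑ᵇ-lookup (true  ∷ as) (b ∷ bs) p rewrite p zero refl = ⊑ᵇ-lookup as bs (p ∘ suc)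
  ⊑ᵇ-lookup (false ∷ as) (b ∷ bs) p = ⊑ᵇ-lookup as bs (p ∘ suc)

  prev : Fin 5 → Fin 5
  prev 0F = 4F
  prev 1F = 0F
  prev 2F = 1F
  prev 3F = 2F
  prev 4F = 3F

  back : ℕ → Fin 5 → Fin 5
  back zero    k = k
  back (suc c) k = back c (prev k)

  full none : Cell
  full = true ∷ true ∷ true ∷ true ∷ true ∷ []
  none = false ∷ false ∷ false ∷ false ∷ false ∷ []

  opaque
    _⊑_ : Cell → Cell → Set
    u ⊑ v = ∀ k → u ! k ≡ true → v ! k ≡ true

    -- Forbid c u v: no k ∈ u, l ∈ v with l - k = c.
    Forbid : ℕ → Cell → Cell → Set
    Forbid c u v = ∀ k → u ! back c k ≡ true → v ! k ≡ true → ⊥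

    _∖[_]_ : Cell → ℕ → Cell → Cell
    A ∖[ c ] u = tabulate λ k → A ! k ∧ not (u ! back c k)

    ⊑-full : ∀ {u} → u ⊑ full
    ⊑-full 0F _ = refl
    ⊑-full 1F _ = refl
    ⊑-full 2F _ = refl
    ⊑-full 3F _ = refl
    ⊑-full 4F _ = refl

    ⊑-trans : ∀ {u v w} → u ⊑ v → v ⊑ w → u ⊑ w
    ⊑-trans p q k = q k ∘ p k

    ⊑-refl : ∀ {u} → u ⊑ u
    ⊑-refl k p = p

    ⊑-∖ : ∀ {v A c u} → v ⊑ A → Forbid c u v → v ⊑ A ∖[ c ] u
    ⊑-∖ {v} {A} {c} {u} p f k q rewrite lookup∘tabulate (λ k → A ! k ∧ not (u ! back c k)) k
      with u ! back c k in eq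
    ... | true  = ⊥-elim (f k eq q)
    ... | false rewrite p k q = refl

    forbid-⊑ : ∀ {c u u′ v} → u′ ⊑ u → Forbid c u v → Forbid c u′ v
    forbid-⊑ p f k q = f k (p _ q)

    ⊑ᵇ⇒⊑ : ∀ {u v : Cell} → u ⊑ᵇ v ≡ true → u ⊑ v
    ⊑ᵇ⇒⊑ {u} {v} = lookup-⊑ᵇ u v

    ⊑⇒⊑ᵇ : ∀ {u v : Cell} → u ⊑ v → u ⊑ᵇ v ≡ true
    ⊑⇒⊑ᵇ {u} {v} = ⊑ᵇ-lookup u v

    size : Cell → ℕ
    size (a ∷ b ∷ c ∷ d ∷ e ∷ []) = bit a + (bit b + (bit c + (bit d + bit e)))

  pattern I = true
  pattern O = false

  -- The independent sets of the 5-cycle on Fin 5 with edges {k , k + 2}.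
  patterns : List Cell
  patterns = none ∷
    (I ∷ O ∷ O ∷ O ∷ O ∷ []) ∷ (O ∷ I ∷ O ∷ O ∷ O ∷ []) ∷ (O ∷ O ∷ I ∷ O ∷ O ∷ []) ∷
    (O ∷ O ∷ O ∷ I ∷ O ∷ []) ∷ (O ∷ O ∷ O ∷ O ∷ I ∷ []) ∷
    (I ∷ I ∷ O ∷ O ∷ O ∷ []) ∷ (O ∷ I ∷ I ∷ O ∷ O ∷ []) ∷ (O ∷ O ∷ I ∷ I ∷ O ∷ []) ∷
    (O ∷ O ∷ O ∷ I ∷ I ∷ []) ∷ (I ∷ O ∷ O ∷ O ∷ I ∷ []) ∷ []

  Independent : Cell → Set
  Independent u = Forbid 2 u u

  opaque
    unfolding Forbid

    independent⇒∈ : ∀ u → Independent u → u ∈ patterns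
    independent⇒∈ (I ∷ b ∷ I ∷ d ∷ e ∷ []) f = ⊥-elim (f 2F refl refl)
    independent⇒∈ (a ∷ I ∷ c ∷ I ∷ e ∷ []) f = ⊥-elim (f 3F refl refl)
    independent⇒∈ (a ∷ b ∷ I ∷ d ∷ I ∷ []) f = ⊥-elim (f 4F refl refl)
    independent⇒∈ (I ∷ b ∷ c ∷ I ∷ e ∷ []) f = ⊥-elim (f 0F refl refl)
    independent⇒∈ (a ∷ I ∷ c ∷ d ∷ I ∷ []) f = ⊥-elim (f 1F refl refl)
    independent⇒∈ (O ∷ O ∷ O ∷ O ∷ O ∷ []) f = here refl
    independent⇒∈ (I ∷ O ∷ O ∷ O ∷ O ∷ []) f = there (here refl)
    independent⇒∈ (O ∷ I ∷ O ∷ O ∷ O ∷ []) f = there (there (here refl))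
    independent⇒∈ (O ∷ O ∷ I ∷ O ∷ O ∷ []) f = there (there (there (here refl)))
    independent⇒∈ (O ∷ O ∷ O ∷ I ∷ O ∷ []) f = there (there (there (there (here refl))))
    independent⇒∈ (O ∷ O ∷ O ∷ O ∷ I ∷ []) f = there (there (there (there (there (here refl)))))
    independent⇒∈ (I ∷ I ∷ O ∷ O ∷ O ∷ []) f = there (there (there (there (there (there (here refl))))))
    independent⇒∈ (O ∷ I ∷ I ∷ O ∷ O ∷ []) f = there (there (there (there (there (there (there (here refl)))))))
    independent⇒∈ (O ∷ O ∷ I ∷ I ∷ O ∷ []) f = there (there (there (there (there (there (there (there (here refl))))))))
    independent⇒∈ (O ∷ O ∷ O ∷ I ∷ I ∷ []) f = there (there (there (there (there (there (there (there (there (here refl)))))))))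
    independent⇒∈ (I ∷ O ∷ O ∷ O ∷ I ∷ []) f = there (there (there (there (there (there (there (there (there (there (here refl))))))))))

  opaque
    options : Cell → List Cell
    options A = filterᵇ (_⊑ᵇ A) patterns

  ∈-filterᵇ : ∀ {X : Set} (p : X → Bool) {x xs} → x ∈ xs → p x ≡ true → x ∈ filterᵇ p xs
  ∈-filterᵇ p {x} {y ∷ xs} (here refl) eq rewrite eq = here refl
  ∈-filterᵇ p {x} {y ∷ xs} (there i)   eq with p y
  ... | true  = there (∈-filterᵇ p i eq)
  ... | false = ∈-filterᵇ p i eq

  opaque
    unfolding options

    ∈-options : ∀ {u A} → Independent u → u ⊑ A → u ∈ options A
    ∈-options {u} {A} i p = ∈-filterᵇ (_⊑ᵇ A) (independent⇒∈ u i) (⊑⇒⊑ᵇ p)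

  any-map : ∀ {X : Set} {P Q : X → Set} {xs} → (∀ x → P x → Q x) → Any P xs → Any Q xs
  any-map f (here p)  = here (f _ p)
  any-map f (there i) = there (any-map f i)

  opaque
    every : ∀ {X : Set} → (X → Bool) → List X → Bool
    every p []       = true
    every p (x ∷ xs) = p x ∧ every p xs

    every-∈ : ∀ {X : Set} {p : X → Bool} {x xs} → every p xs ≡ true → x ∈ xs → p x ≡ true
    every-∈ {p = p} {xs = y ∷ xs} eq i with p y in e
    every-∈ {p = p} {xs = y ∷ xs} eq (here refl) | true = e
    every-∈ {p = p} {xs = y ∷ xs} eq (there i)   | true = every-∈ eq i

    both : Bool → Bool → Bool
    both = _∧_

    both-split : ∀ {a b} → both a b ≡ true → a ≡ true × b ≡ true
    both-split {true} {true} _ = refl , refl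

  -- What is remembered after j columns: lower bounds for u 1, v 1 and v 2, which are needed again
  -- for the last columns; upper bounds for u and v at columns j + 1, j + 2 and ≥ j + 3; and how much
  -- the total size exceeds 2 j - 2.  Once the excess is truncated to 0, nothing else matters, so the
  -- state can be weakened to top, which keeps the set of reachable states small.
  record State : Set where
    constructor state
    field
      u₁ v₁ v₂          : Cell
      A₁ A₂ A₃ B₁ B₂ B₃ : Cell
      excess            : ℕ

  open State

  below : State → State → Bool
  below (state u v w A A′ A″ B B′ B″ e) (state u₀ v₀ w₀ A₀ A₀′ A₀″ B₀ B₀′ B₀″ e₀) =
    (e ≤ᵇ e₀) ∧ (A″ ⊑ᵇ A₀″) ∧ (B″ ⊑ᵇ B₀″) ∧ (A ⊑ᵇ A₀) ∧ (A′ ⊑ᵇ A₀′) ∧ (B ⊑ᵇ B₀) ∧ (B′ ⊑ᵇ B₀′) ∧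
    (u₀ ⊑ᵇ u) ∧ (v₀ ⊑ᵇ v) ∧ (w₀ ⊑ᵇ w)

  top : State
  top = state none none none full full full full full full 0

  -- With 0 and q in the set, a coset reached by the shift c loses the places c and c + 1 modulo 5.
  -- The shift is 4 for the indices 1 and 2, then 1 up to h - 1, 3 at h, 1 at h + 1, 3 up to 2 h -
  -- 2, and 0 for the last two, in the order of these six cells.
  startᵤ inᵤ lastᵤ firstᵥ inᵥ endᵥ : Cell
  startᵤ = O ∷ I ∷ I ∷ I ∷ O ∷ []
  inᵤ    = I ∷ O ∷ O ∷ I ∷ I ∷ []
  lastᵤ  = I ∷ I ∷ I ∷ O ∷ O ∷ []
  firstᵥ = I ∷ O ∷ O ∷ I ∷ I ∷ []
  inᵥ    = I ∷ I ∷ I ∷ O ∷ O ∷ []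
  endᵥ   = O ∷ O ∷ I ∷ I ∷ I ∷ []

  infixl 6 _∩_
  opaque
    unfolding _⊑_

    _∩_ : Cell → Cell → Cell
    A ∩ B = tabulate λ k → A ! k ∧ B ! k

    ⊑-∩ : ∀ {u A B} → u ⊑ A → u ⊑ B → u ⊑ A ∩ B
    ⊑-∩ {u} {A} {B} p q k r rewrite lookup∘tabulate (λ k → A ! k ∧ B ! k) k | p k r | q k r = refl

  -- The window moves by one column: the old bounds for distance 2 become those for distance 1, and
  -- the old far bounds feed both distance 2 and the new far bounds. The shifts are the regular ones
  -- of `Word`, and the `∸ 2` is the column's quota.
  advance : State → Cell → Cell → State
  advance (state u v w A₁ A₂ A₃ B₁ B₂ B₃ e) x y = state u v w
    (A₂ ∖[ 4 ] x ∖[ 4 ] y) (A₃ ∖[ 4 ] x ∖[ 4 ] y) (A₃ ∖[ 1 ] x ∖[ 4 ] y)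
    (B₂ ∖[ 1 ] x ∖[ 4 ] y) (B₃ ∖[ 3 ] x ∖[ 4 ] y) (B₃ ∖[ 3 ] x ∖[ 1 ] y)
    (e + (size x + size y) ∸ 2)

  -- Since u 1, v 1 and v 2 act on the last columns by exceptional shifts, their effect cannot be
  -- accumulated in advance. It is applied when a column is read, here and in `step` with the
  -- regular shifts.
  column : State → Cell → List State
  column s x = map (advance s x) (options (inᵥ ∩ B₁ s ∖[ 3 ] x ∖[ 3 ] u₁ s))

  step : State → List State
  step s = concatMap (column s) (options (inᵤ ∩ A₁ s ∖[ 4 ] v₁ s ∖[ 4 ] v₂ s))

  -- Columns h - 1 and h, where the exceptions occur: v 1 acts on both by 1, v 2 by 4 and then 1, u
  -- 1 by 3 and then 0. As `excess` is relative to 2 j - 2 and h = j + 2, the bound 2 h leaves room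
  -- for 6.
  finish : State → Bool
  finish s =
    every (λ x → every (λ y → let s′ = advance s x y in
        every (λ x′ → every (λ y′ → excess s + (size x + size y) + (size x′ + size y′) ≤ᵇ 6)
            (options (endᵥ ∩ B₁ s′ ∖[ 3 ] x′ ∖[ 0 ] u₁ s)))
          (options (lastᵤ ∩ A₁ s′ ∖[ 1 ] v₁ s ∖[ 1 ] v₂ s)))
      (options (endᵥ ∩ B₁ s ∖[ 3 ] x ∖[ 3 ] u₁ s)))
    (options (inᵤ ∩ A₁ s ∖[ 1 ] v₁ s ∖[ 4 ] v₂ s))

  -- A state below `top` counts as covered even if `top` is not in L. A run that gets there leaves L
  -- and continues in `topStates`, one list shared by all beginnings.
  covered : List State → State → Bool
  covered L s = below s top ∨ any (below s) L

  insert : State → List State → List State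
  insert s L = if covered L s then L else s ∷ L

  next : List State → List State
  next L = foldr insert [] (concatMap step L)

  -- The number of rounds needs no justification: whether a closed set has been reached is tested
  -- afterwards by `closed`.
  saturate : ℕ → List State → List State
  saturate zero    L = L
  saturate (suc k) L = saturate k (foldr insert L (concatMap step L))

  closed : List State → Bool
  closed L = every (λ s → every (covered L) (step s)) L

  invariant : List State → Bool
  invariant L = both (closed L) (every finish L)

  opaque
    topStates : List State
    topStates = saturate 6 (top ∷ [])

  -- Only u 2 is enumerated. The effect of u 1 on later v, and of v 1 and v 2 on later u, is left
  -- out of the bounds and imposed column by column.
  begin₂ : Cell → Cell → Cell → List State
  begin₂ x y y′ = map (λ x′ → state x y y′
      (full ∖[ 4 ] x ∖[ 4 ] x′) (full ∖[ 1 ] x ∖[ 4 ] x′) (full ∖[ 1 ] x ∖[ 1 ] x′)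
      (full ∖[ 1 ] x′ ∖[ 4 ] y ∖[ 4 ] y′) (full ∖[ 3 ] x′ ∖[ 1 ] y ∖[ 4 ] y′) (full ∖[ 3 ] x′ ∖[ 1 ] y ∖[ 1 ] y′)
      (size x + size y + (size x′ + size y′) ∸ 2))
    (filterᵇ (λ x′ → y′ ⊑ᵇ full ∖[ 3 ] x′) (options (startᵤ ∖[ 4 ] x ∖[ 4 ] y)))

  -- For h = 7 just the columns 3, 4 and 5 lie between the first two and the last two. Reading these
  -- before saturating means that `finish` is tested, apart from `topStates`, only on states reached
  -- at column 5 or later.
  column₅ : Cell → Cell → Cell → List State
  column₅ x y y′ = saturate 2 (next (next (next (begin₂ x y y′))))

  -- No transition changes u 1, v 1 and v 2, so each such triple gets its own closed set.
  starts : Bool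
  starts = every (λ x → every (λ y → every (λ y′ → invariant (column₅ x y y′))
      (options (inᵥ ∖[ 1 ] x ∖[ 4 ] y)))
    (options (firstᵥ ∖[ 3 ] x)))
    (options startᵤ)

  -- The constraints on the traces u i and v i of an independent set on the cosets of i and h + i,
  -- when the set contains 0 and q.
  record Word (h : ℕ) (u v : ℕ → Cell) : Set where
    field
      u-indep : ∀ {i} → 1 ≤ i → i ≤ h → Independent (u i)
      v-indep : ∀ {i} → 1 ≤ i → i ≤ h → Independent (v i)
      uu-near : ∀ {i j} → 1 ≤ i → i < j → j ≤ 2 + i → j ≤ h → Forbid 4 (u i) (u j)
      uu-far  : ∀ {i j} → 1 ≤ i → 3 + i ≤ j → j ≤ h → Forbid 1 (u i) (u j)
      vv-near : ∀ {i j} → 1 ≤ i → i < j → j ≤ 2 + i → j ≤ h → Forbid 4 (v i) (v j)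
      vv-far  : ∀ {i j} → 1 ≤ i → 3 + i ≤ j → j ≤ h → Forbid 1 (v i) (v j)
      uv-same : ∀ {i} → 1 ≤ i → i ≤ h → Forbid 3 (u i) (v i)
      uv-next : ∀ {i} → 1 ≤ i → i < h → Forbid 1 (u i) (v (suc i))
      uv-far  : ∀ {i j} → 1 ≤ i → 2 + i ≤ j → j ≤ h → 2 + j ≤ i + h → Forbid 3 (u i) (v j)
      uv-wrap : Forbid 0 (u 1) (v h)
      vu      : ∀ {i j} → 1 ≤ i → i < j → j ≤ h → 3 + j ≤ i + h → Forbid 4 (v i) (u j)
      vu-wrap : ∀ {i j} → 1 ≤ i → i < j → j ≤ h → i + h ≤ 2 + j → Forbid 1 (v i) (u j)
      u-start : ∀ {i} → 1 ≤ i → i ≤ 2 → u i ⊑ startᵤ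
      u-in    : ∀ {i} → 3 ≤ i → i < h → u i ⊑ inᵤ
      u-last  : u h ⊑ lastᵤ
      v-first : v 1 ⊑ firstᵥ
      v-in    : ∀ {i} → 2 ≤ i → 2 + i ≤ h → v i ⊑ inᵥ
      v-end   : ∀ {i} → i ≤ h → h ≤ suc i → v i ⊑ endᵥ

  total : (u v : ℕ → Cell) → ℕ → ℕ
  total u v zero    = 0
  total u v (suc j) = total u v j + (size (u (suc j)) + size (v (suc j)))

  opaque
    unfolding every both topStates options _∖[_]_ _∩_ size

    top-invariant : invariant topStates ≡ true
    top-invariant = refl

    starts-invariant : starts ≡ true
    starts-invariant = refl

  ∧-split : ∀ {a b} → a ∧ b ≡ true → a ≡ true × b ≡ true
  ∧-split {true} {true} _ = refl , refl

  any⇒Any : ∀ {X : Set} (p : X → Bool) xs → any p xs ≡ true → Any (λ x → p x ≡ true) xs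
  any⇒Any p (x ∷ xs) eq with p x in e
  ... | true  = here e
  ... | false = there (any⇒Any p xs eq)

  -- Soundness of the automaton

  module Run {h : ℕ} (7≤h : 7 ≤ h) {u v : ℕ → Cell} (W : Word h u v) where
    open Word W

    record Holds (j : ℕ) (s : State) : Set where
      field
        u₁⊑ : u₁ s ⊑ u 1
        v₁⊑ : v₁ s ⊑ v 1
        v₂⊑ : v₂ s ⊑ v 2
        ⊑A₁ : 1 + j ≤ h → u (1 + j) ⊑ A₁ s
        ⊑A₂ : 2 + j ≤ h → u (2 + j) ⊑ A₂ s
        ⊑A₃ : ∀ {i} → 3 + j ≤ i → i ≤ h → u i ⊑ A₃ s
        ⊑B₁ : 1 + j ≤ h → v (1 + j) ⊑ B₁ s
        ⊑B₂ : 2 + j ≤ h → v (2 + j) ⊑ B₂ s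
        ⊑B₃ : ∀ {i} → 3 + j ≤ i → i ≤ h → v i ⊑ B₃ s
        bound : total u v j + 2 ≤ 2 * j + excess s

    open Holds

    holds-below : ∀ {j s s′} → below s s′ ≡ true → Holds j s → Holds j s′
    holds-below {j} {s} {s′} eq H
      with p₀ , eq ← ∧-split eq with p₁ , eq ← ∧-split eq with p₂ , eq ← ∧-split eq
      with p₃ , eq ← ∧-split eq with p₄ , eq ← ∧-split eq with p₅ , eq ← ∧-split eq
      with p₆ , eq ← ∧-split eq with p₇ , eq ← ∧-split eq with p₈ , p₉ ← ∧-split eq = record
      { u₁⊑ = ⊑-trans (sub p₇) (u₁⊑ H)
      ; v₁⊑ = ⊑-trans (sub p₈) (v₁⊑ H)
      ; v₂⊑ = ⊑-trans (sub p₉) (v₂⊑ H)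
      ; ⊑A₁ = λ b → ⊑-trans (⊑A₁ H b) (sub p₃)
      ; ⊑A₂ = λ b → ⊑-trans (⊑A₂ H b) (sub p₄)
      ; ⊑A₃ = λ a b → ⊑-trans (⊑A₃ H a b) (sub p₁)
      ; ⊑B₁ = λ b → ⊑-trans (⊑B₁ H b) (sub p₅)
      ; ⊑B₂ = λ b → ⊑-trans (⊑B₂ H b) (sub p₆)
      ; ⊑B₃ = λ a b → ⊑-trans (⊑B₃ H a b) (sub p₂)
      ; bound = ≤-trans (bound H) (+-monoʳ-≤ (2 * j) (≤ᵇ⇒≤ _ _ (subst T (sym p₀) tt)))
      }
      where
      sub : ∀ {a b : Cell} → a ⊑ᵇ b ≡ true → a ⊑ b
      sub = ⊑ᵇ⇒⊑

    module _ {j : ℕ} (2≤j : 2 ≤ j) {s : State} (H : Holds j s) where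

      private
        x y : Cell
        x = u (suc j)
        y = v (suc j)

        1≤ : 1 ≤ suc j
        1≤ = s≤s z≤n

      -- The new column has index at least 3, and the exceptional pairs at the ends involve only u
      -- 1, v 1 and v 2. Hence it acts on all later columns by the regular shifts; the side
      -- conditions check this.
      holds-advance : 1 + j < h → Holds (suc j) (advance s x y)
      holds-advance b = record
        { u₁⊑ = u₁⊑ H
        ; v₁⊑ = v₁⊑ H
        ; v₂⊑ = v₂⊑ H
        ; ⊑A₁ = λ b → ⊑-∖ (⊑-∖ (⊑A₂ H b) (uu-near 1≤ ≤-refl (n≤1+n _) b)) (vu {suc j} {2 + j} 1≤ ≤-refl b
              (linear (lit 1 :+ x₀ :< x₁ :∧ lit 2 :≤ x₀ :∧ lit 7 :≤ x₁) (lit 3 :+ (lit 2 :+ x₀) :≤ lit 1 :+ x₀ :+ x₁) (j ∷ h ∷ []) refl (b , 2≤j , 7≤h)))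
        ; ⊑A₂ = λ b → ⊑-∖ (⊑-∖ (⊑A₃ H ≤-refl b) (uu-near 1≤ (n≤1+n _) ≤-refl b))
              (vu {suc j} {3 + j} 1≤ (n≤1+n _) b
                (linear (lit 2 :+ (lit 1 :+ x₀) :≤ x₁ :∧ lit 2 :≤ x₀ :∧ lit 7 :≤ x₁) (lit 3 :+ (lit 3 :+ x₀) :≤ lit 1 :+ x₀ :+ x₁) (j ∷ h ∷ []) refl (b , 2≤j , 7≤h)))
        ; ⊑A₃ = λ {i} a b → ⊑-∖ (⊑-∖ (⊑A₃ H (≤-trans (n≤1+n _) a) b) (uu-far 1≤ a b)) (vu {suc j} {i} 1≤
              (linear (lit 3 :+ (lit 1 :+ x₀) :≤ x₁) (lit 2 :+ x₀ :≤ x₁) (j ∷ i ∷ []) refl a) b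
                (linear (x₀ :≤ x₁ :∧ lit 2 :≤ x₂ :∧ lit 3 :+ (lit 1 :+ x₂) :≤ x₀) (lit 3 :+ x₀ :≤ lit 1 :+ x₂ :+ x₁) (i ∷ h ∷ j ∷ []) refl (b , 2≤j , a)))
        ; ⊑B₁ = λ b → ⊑-∖ (⊑-∖ (⊑B₂ H b) (uv-next 1≤ b)) (vv-near 1≤ ≤-refl (n≤1+n _) b)
        ; ⊑B₂ = λ b → ⊑-∖ (⊑-∖ (⊑B₃ H ≤-refl b) (uv-far {suc j} {3 + j} 1≤ ≤-refl b
              (linear (lit 2 :+ (lit 1 :+ x₀) :≤ x₁ :∧ lit 2 :≤ x₀ :∧ lit 7 :≤ x₁) (lit 2 :+ (lit 3 :+ x₀) :≤ lit 1 :+ x₀ :+ x₁) (j ∷ h ∷ []) refl (b , 2≤j , 7≤h)))) (vv-near 1≤ (n≤1+n _) ≤-refl b)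
        ; ⊑B₃ = λ {i} a b → ⊑-∖ (⊑-∖ (⊑B₃ H (≤-trans (n≤1+n _) a) b)
              (uv-far {suc j} {i} 1≤ (≤-trans (n≤1+n _) a) b
                (linear (x₀ :≤ x₁ :∧ lit 2 :≤ x₂ :∧ lit 3 :+ (lit 1 :+ x₂) :≤ x₀) (lit 2 :+ x₀ :≤ lit 1 :+ x₂ :+ x₁) (i ∷ h ∷ j ∷ []) refl (b , 2≤j , a)))) (vv-far 1≤ a b)
        ; bound = step-bound (total u v j) (size x + size y) j (excess s) (bound H)
        }
        where
        -- Truncation errs on the safe side: e + z ≤ 2 + (e + z ∸ 2) holds even when the difference
        -- is cut off at 0.
        step-bound : ∀ w z j e → w + 2 ≤ 2 * j + e → w + z + 2 ≤ 2 * suc j + (e + z ∸ 2)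
        step-bound w z j e p = linear (x₀ :+ lit 2 :≤ 2 :* x₁ :+ x₂ :∧ x₂ :+ x₃ :≤ lit 2 :+ x₄) (x₀ :+ x₃ :+ lit 2 :≤ 2 :* (lit 1 :+ x₁) :+ x₄) (w ∷ j ∷ e ∷ z ∷ e + z ∸ 2 ∷ []) refl (p , m≤n+m∸n (e + z) 2)

      ∈-step : 3 + j ≤ h → Any (Holds (suc j)) (step s)
      ∈-step b = lose (∈-concatMap⁺ (column s) (lose
          (∈-options (u-indep 1≤ (<⇒≤ (<⇒≤ b)))
            (⊑-∖ (⊑-∖ (⊑-∩ (u-in (s≤s 2≤j) (<⇒≤ b)) (⊑A₁ H (<⇒≤ (<⇒≤ b))))
              (forbid-⊑ (v₁⊑ H) (vu {1} {suc j} ≤-refl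
                (linear (lit 2 :≤ x₀ :∧ lit 3 :+ x₀ :≤ x₁) (lit 1 :< lit 1 :+ x₀) (j ∷ h ∷ []) refl (2≤j , b))
                  (linear (lit 3 :+ x₀ :≤ x₁) (x₀ :< x₁) (j ∷ h ∷ []) refl b)
                    (linear (lit 3 :+ x₀ :≤ x₁) (lit 3 :+ (lit 1 :+ x₀) :≤ lit 1 :+ x₁) (j ∷ h ∷ []) refl b))))
              (forbid-⊑ (v₂⊑ H) (vu {2} {suc j} (s≤s z≤n)
                (linear (lit 2 :≤ x₀ :∧ lit 3 :+ x₀ :≤ x₁) (lit 2 :< lit 1 :+ x₀) (j ∷ h ∷ []) refl (2≤j , b))
                  (linear (lit 3 :+ x₀ :≤ x₁) (x₀ :< x₁) (j ∷ h ∷ []) refl b)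
                    (linear (lit 3 :+ x₀ :≤ x₁) (lit 3 :+ (lit 1 :+ x₀) :≤ lit 2 :+ x₁) (j ∷ h ∷ []) refl b)))))
          (∈-map⁺ (advance s x)
            (∈-options (v-indep 1≤ (<⇒≤ (<⇒≤ b)))
              (⊑-∖ (⊑-∖ (⊑-∩ (v-in {suc j}
                (linear (lit 2 :≤ x₀ :∧ lit 3 :+ x₀ :≤ x₁) (lit 2 :≤ lit 1 :+ x₀) (j ∷ h ∷ []) refl
                  (2≤j , b)) b) (⊑B₁ H (<⇒≤ (<⇒≤ b))))
                (uv-same 1≤ (<⇒≤ (<⇒≤ b))))
                (forbid-⊑ (u₁⊑ H) (uv-far {1} {suc j} ≤-refl
                  (linear (lit 2 :≤ x₀ :∧ lit 3 :+ x₀ :≤ x₁) (lit 2 :+ lit 1 :≤ lit 1 :+ x₀) (j ∷ h ∷ []) refl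
                    (2≤j , b)) (linear (lit 3 :+ x₀ :≤ x₁) (x₀ :< x₁) (j ∷ h ∷ []) refl b)
                      (linear (lit 3 :+ x₀ :≤ x₁) (lit 2 :+ (lit 1 :+ x₀) :≤ lit 1 :+ x₁) (j ∷ h ∷ []) refl b))))))))
        (holds-advance (<⇒≤ b))

    holds-finish : ∀ {j s} → 2 ≤ j → 2 + j ≡ h → Holds j s → finish s ≡ true → total u v h ≤ 2 * h
    holds-finish {j} {s} 2≤j refl H eq =
      linear (x₀ :+ lit 2 :≤ 2 :* x₁ :+ x₂ :∧ x₂ :+ (x₃ :+ x₄) :+ (x₅ :+ x₆) :≤ lit 6) (x₀ :+ (x₃ :+ x₄) :+ (x₅ :+ x₆) :≤ 2 :* (lit 2 :+ x₁)) (total u v j ∷ j ∷ excess s ∷ size (u (suc j)) ∷ size (v (suc j)) ∷ size (u (suc (suc j))) ∷ size (v (suc (suc j))) ∷ []) refl (bound H , ≤ᵇ⇒≤ (excess s + (size (u (suc j)) + size (v (suc j))) + (size (u (suc (suc j))) + size (v (suc (suc j))))) 6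
                       (subst T (sym last) tt))
      where
      H′ = holds-advance 2≤j H ≤-refl
      last = every-∈ (every-∈ (every-∈ (every-∈ eq
          (∈-options (u-indep (s≤s z≤n) (n≤1+n _))
            (⊑-∖ (⊑-∖ (⊑-∩ (u-in (s≤s 2≤j) ≤-refl) (⊑A₁ H (n≤1+n _)))
              (forbid-⊑ (v₁⊑ H) (vu-wrap {1} {suc j} ≤-refl
                (linear (lit 2 :≤ x₀) (lit 1 :< lit 1 :+ x₀) (j ∷ []) refl 2≤j) (n≤1+n _) ≤-refl)))
              (forbid-⊑ (v₂⊑ H) (vu {2} {suc j} (s≤s z≤n)
                (linear (lit 2 :≤ x₀) (lit 2 :< lit 1 :+ x₀) (j ∷ []) refl 2≤j) (n≤1+n _) ≤-refl)))))
          (∈-options (v-indep (s≤s z≤n) (n≤1+n _))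
            (⊑-∖ (⊑-∖ (⊑-∩ (v-end (n≤1+n _) ≤-refl) (⊑B₁ H (n≤1+n _)))
              (uv-same (s≤s z≤n) (n≤1+n _)))
              (forbid-⊑ (u₁⊑ H) (uv-far ≤-refl (s≤s 2≤j) (n≤1+n _) ≤-refl)))))
          (∈-options (u-indep (s≤s z≤n) ≤-refl)
            (⊑-∖ (⊑-∖ (⊑-∩ u-last (⊑A₁ H′ ≤-refl))
              (forbid-⊑ (v₁⊑ H) (vu-wrap {1} {2 + j} ≤-refl
                (linear (lit 2 :≤ x₀) (lit 1 :< lit 2 :+ x₀) (j ∷ []) refl 2≤j) ≤-refl (n≤1+n _))))
              (forbid-⊑ (v₂⊑ H) (vu-wrap {2} {2 + j} (s≤s z≤n)
                (linear (lit 2 :≤ x₀) (lit 2 :< lit 2 :+ x₀) (j ∷ []) refl 2≤j) ≤-refl ≤-refl)))))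
          (∈-options (v-indep (s≤s z≤n) ≤-refl)
            (⊑-∖ (⊑-∖ (⊑-∩ (v-end ≤-refl (n≤1+n _)) (⊑B₁ H′ ≤-refl))
              (uv-same (s≤s z≤n) ≤-refl))
              (forbid-⊑ (u₁⊑ H) uv-wrap)))

    holds-covered : ∀ {j s} L → covered L s ≡ true → Holds j s → Holds j top ⊎ Any (Holds j) L
    holds-covered {s = s} L eq H with below s top in e
    ... | true  = inj₁ (holds-below e H)
    ... | false = inj₂ (any-map (λ s′ p → holds-below p H) (any⇒Any (below s) L eq))

    holds-insert : ∀ {j} s L → Holds j s → Holds j top ⊎ Any (Holds j) (insert s L)
    holds-insert s L H with covered L s in e
    ... | true  = holds-covered L e H
    ... | false = inj₂ (here H)

    insert-⊇ : ∀ {j} s L → Any (Holds j) L → Any (Holds j) (insert s L)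
    insert-⊇ s L i with covered L s
    ... | true  = i
    ... | false = there i

    holds-foldr : ∀ {j} L xs → Any (Holds j) xs → Holds j top ⊎ Any (Holds j) (foldr insert L xs)
    holds-foldr L (x ∷ xs) (here H)  = holds-insert x _ H
    holds-foldr L (x ∷ xs) (there i) = Sum.map₂ (insert-⊇ x _) (holds-foldr L xs i)

    foldr-⊇ : ∀ {j} L xs → Any (Holds j) L → Any (Holds j) (foldr insert L xs)
    foldr-⊇ L []       i = i
    foldr-⊇ L (x ∷ xs) i = insert-⊇ x _ (foldr-⊇ L xs i)

    saturate-⊇ : ∀ {j} k L → Any (Holds j) L → Any (Holds j) (saturate k L)
    saturate-⊇ zero    L i = i
    saturate-⊇ (suc k) L i = saturate-⊇ k _ (foldr-⊇ L (concatMap step L) i)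

    opaque
      unfolding topStates

      top-⊆ : ∀ {j} → Holds j top → Any (Holds j) topStates
      top-⊆ H = saturate-⊇ 6 (top ∷ []) (here H)

    holds-steps : ∀ {j} L → 2 ≤ j → 3 + j ≤ h → Any (Holds j) L → Any (Holds (suc j)) (concatMap step L)
    holds-steps L 2≤j b i with s , s∈L , H ← find i with s′ , s′∈ , H′ ← find (∈-step 2≤j H b) =
      lose (∈-concatMap⁺ step (lose s∈L s′∈)) H′

    holds-next : ∀ {j} L → 2 ≤ j → 3 + j ≤ h → Any (Holds j) L →
      Holds (suc j) top ⊎ Any (Holds (suc j)) (next L)
    holds-next L 2≤j b i = holds-foldr [] (concatMap step L) (holds-steps L 2≤j b i)

    holds-closed : ∀ {j} L → closed L ≡ true → 2 ≤ j → 3 + j ≤ h → Any (Holds j) L →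
      Holds (suc j) top ⊎ Any (Holds (suc j)) L
    holds-closed L eq 2≤j b i with s , s∈L , H ← find i with s′ , s′∈ , H′ ← find (∈-step 2≤j H b) =
      holds-covered L (every-∈ (every-∈ eq s∈L) s′∈) H′

    finish-list : ∀ {j} L → every finish L ≡ true → 2 ≤ j → 2 + j ≡ h → Any (Holds j) L → total u v h ≤ 2 * h
    finish-list L eq 2≤j e i with s , s∈L , H ← find i = holds-finish 2≤j e H (every-∈ eq s∈L)

    from-top : ∀ d {j} → d + (2 + j) ≡ h → 2 ≤ j → Any (Holds j) topStates → total u v h ≤ 2 * h
    from-top zero    e 2≤j i = finish-list topStates (proj₂ (both-split top-invariant)) 2≤j e i
    from-top (suc d) {j} e 2≤j i
      with holds-closed topStates (proj₁ (both-split top-invariant)) 2≤j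
            (linear (lit 1 :+ x₀ :+ (lit 2 :+ x₁) :≡ x₂) (lit 3 :+ x₁ :≤ x₂) (d ∷ j ∷ h ∷ []) refl e) i
    ... | inj₁ H  = from-top d {suc j}
          (linear (lit 1 :+ (x₀ :+ (lit 2 :+ x₁)) :≡ x₂) (x₀ :+ (lit 2 :+ (lit 1 :+ x₁)) :≡ x₂) (d ∷ j ∷ h ∷ []) refl e) (m≤n⇒m≤1+n 2≤j) (top-⊆ H)
    ... | inj₂ i′ = from-top d {suc j}
          (linear (lit 1 :+ (x₀ :+ (lit 2 :+ x₁)) :≡ x₂) (x₀ :+ (lit 2 :+ (lit 1 :+ x₁)) :≡ x₂) (d ∷ j ∷ h ∷ []) refl e) (m≤n⇒m≤1+n 2≤j) i′

    from-top₁ : ∀ {j} → 2 ≤ j → 2 + j ≤ h → Holds j top → total u v h ≤ 2 * h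
    from-top₁ {j} 2≤j b H = from-top (h ∸ (2 + j)) (m∸n+n≡m b) 2≤j (top-⊆ H)

    -- The closed list does not depend on j, so one test serves all h. The induction is on the
    -- number d of ordinary columns left before the last two.
    from-invariant : ∀ d {j} L → invariant L ≡ true → d + (2 + j) ≡ h → 2 ≤ j → Any (Holds j) L → total u v h ≤ 2 * h
    from-invariant zero    L eq e 2≤j i = finish-list L (proj₂ (both-split eq)) 2≤j e i
    from-invariant (suc d) {j} L eq e 2≤j i
      with holds-closed L (proj₁ (both-split eq)) 2≤j
            (linear (lit 1 :+ x₀ :+ (lit 2 :+ x₁) :≡ x₂) (lit 3 :+ x₁ :≤ x₂) (d ∷ j ∷ h ∷ []) refl e) i
    ... | inj₁ H  = from-top₁ {suc j} (m≤n⇒m≤1+n 2≤j)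
          (linear (lit 1 :+ (x₀ :+ (lit 2 :+ x₁)) :≡ x₂) (lit 2 :+ (lit 1 :+ x₁) :≤ x₂) (d ∷ j ∷ h ∷ []) refl e) H
    ... | inj₂ i′ = from-invariant d {suc j} L eq
          (linear (lit 1 :+ (x₀ :+ (lit 2 :+ x₁)) :≡ x₂) (x₀ :+ (lit 2 :+ (lit 1 :+ x₁)) :≡ x₂) (d ∷ j ∷ h ∷ []) refl e) (m≤n⇒m≤1+n 2≤j) i′

    1≤h : 1 ≤ h
    1≤h = ≤-trans (s≤s z≤n) 7≤h

    2≤h : 2 ≤ h
    2≤h = ≤-trans (s≤s (s≤s z≤n)) 7≤h

    holds-begin : Any (Holds 2) (begin₂ (u 1) (v 1) (v 2))
    holds-begin = lose (∈-map⁺ _ (∈-filterᵇ (λ x → v 2 ⊑ᵇ full ∖[ 3 ] x)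
        (∈-options (u-indep (s≤s z≤n) 2≤h)
          (⊑-∖ (⊑-∖ (u-start (s≤s z≤n) ≤-refl) (uu-near ≤-refl ≤-refl (n≤1+n _) 2≤h))
            (vu {1} {2} ≤-refl ≤-refl 2≤h
              (linear (lit 7 :≤ x₀) (lit 3 :+ lit 2 :≤ lit 1 :+ x₀) (h ∷ []) refl 7≤h))))
        (⊑⇒⊑ᵇ (⊑-∖ ⊑-full (uv-same (s≤s z≤n) 2≤h)))))
      record
      { u₁⊑ = ⊑-refl
      ; v₁⊑ = ⊑-refl
      ; v₂⊑ = ⊑-refl
      ; ⊑A₁ = λ b → ⊑-∖ (⊑-∖ ⊑-full (uu-near ≤-refl (n≤1+n _) ≤-refl b)) (uu-near (s≤s z≤n) ≤-refl (n≤1+n _) b)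
      ; ⊑A₂ = λ b → ⊑-∖ (⊑-∖ ⊑-full (uu-far ≤-refl ≤-refl b)) (uu-near (s≤s z≤n) (n≤1+n _) ≤-refl b)
      ; ⊑A₃ = λ a b → ⊑-∖ (⊑-∖ ⊑-full (uu-far ≤-refl (≤-trans (n≤1+n _) a) b)) (uu-far (s≤s z≤n) a b)
      ; ⊑B₁ = λ b → ⊑-∖ (⊑-∖ (⊑-∖ ⊑-full (uv-next (s≤s z≤n) b)) (vv-near ≤-refl (n≤1+n _) ≤-refl b))
            (vv-near (s≤s z≤n) ≤-refl (n≤1+n _) b)
      ; ⊑B₂ = λ b → ⊑-∖ (⊑-∖ (⊑-∖ ⊑-full (uv-far {2} {4} (s≤s z≤n) ≤-refl b
            (linear (lit 7 :≤ x₀) (lit 2 :+ lit 4 :≤ lit 2 :+ x₀) (h ∷ []) refl 7≤h)))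
              (vv-far ≤-refl ≤-refl b)) (vv-near (s≤s z≤n) (n≤1+n _) ≤-refl b)
      ; ⊑B₃ = λ {i} a b → ⊑-∖ (⊑-∖ (⊑-∖ ⊑-full (uv-far {2} {i} (s≤s z≤n) (≤-trans (n≤1+n _) a) b
            (linear (x₀ :≤ x₁) (lit 2 :+ x₀ :≤ lit 2 :+ x₁) (i ∷ h ∷ []) refl b)))
              (vv-far ≤-refl (≤-trans (n≤1+n _) a) b)) (vv-far (s≤s z≤n) a b)
      ; bound = begin-bound (size (u 1)) (size (v 1)) (size (u 2)) (size (v 2))
      }
      where
      begin-bound : ∀ a b c d → 0 + (a + b) + (c + d) + 2 ≤ 2 * 2 + (a + b + (c + d) ∸ 2)
      begin-bound a b c d = linear (x₀ :+ x₁ :+ (x₂ :+ x₃) :≤ lit 2 :+ x₄) (lit 0 :+ (x₀ :+ x₁) :+ (x₂ :+ x₃) :+ lit 2 :≤ 2 :* lit 2 :+ x₄) (a ∷ b ∷ c ∷ d ∷ a + b + (c + d) ∸ 2 ∷ []) refl (m≤n+m∸n (a + b + (c + d)) 2)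

    start-invariant : invariant (column₅ (u 1) (v 1) (v 2)) ≡ true
    start-invariant = every-∈ (every-∈ (every-∈ starts-invariant
        (∈-options (u-indep ≤-refl 1≤h) (u-start ≤-refl (s≤s z≤n))))
        (∈-options (v-indep ≤-refl 1≤h) (⊑-∖ v-first (uv-same ≤-refl 1≤h))))
        (∈-options (v-indep (s≤s z≤n) 2≤h)
          (⊑-∖ (⊑-∖ (v-in ≤-refl (≤-trans (m≤m+n 4 3) 7≤h)) (uv-next ≤-refl 2≤h))
              (vv-near ≤-refl ≤-refl (n≤1+n _) 2≤h)))

    total≤ : total u v h ≤ 2 * h
    total≤ =
      Sum.[ from-top₁ (m≤m+n 2 1) (≤-trans (m≤m+n 5 2) 7≤h) , (λ i →
      Sum.[ from-top₁ (m≤m+n 2 2) (≤-trans (m≤m+n 6 1) 7≤h) , (λ i →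
      Sum.[ from-top₁ (m≤m+n 2 3) 7≤h , (λ i →
        -- At column 5, with two columns reserved for `finish`, h - 7 ordinary ones remain. The
        -- enclosing cases handle a run that falls to `top` at column 3, 4 or 5.
        from-invariant (h ∸ 7) (saturate 2 L₅) start-invariant (m∸n+n≡m 7≤h) (m≤m+n 2 3) (saturate-⊇ 2 L₅ i)) ]′
      (holds-next L₄ (m≤m+n 2 2) 7≤h i)) ]′
      (holds-next L₃ (m≤m+n 2 1) (≤-trans (m≤m+n 6 1) 7≤h) i)) ]′
      (holds-next L₂ ≤-refl (≤-trans (m≤m+n 5 2) 7≤h) holds-begin)
      where
      L₂ L₃ L₄ L₅ : List State
      L₂ = begin₂ (u 1) (v 1) (v 2)
      L₃ = next L₂
      L₄ = next L₃
      L₅ = next L₄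

-- From a set of residues to its columns

module Traces where

  open import Data.Bool.Base using (Bool; true; false)
  import Data.List.Membership.Propositional as List
  open import Data.List.Base using (List; []; _∷_; drop)
  open import Data.Empty using (⊥; ⊥-elim)
  open import Data.Fin.Base using (Fin; zero; suc)
  open import Data.Fin.Patterns
  open import Data.Fin.Subset using (_∈_)
  open import Data.Nat.Base
  open import Data.Nat.Properties
  open import Data.Product.Base using (_,_)
  open import Data.Unit.Base using (tt)
  open import Data.Sum.Base as Sum using ()
  open import Data.Vec.Base using ([]; _∷_)
  open import Function.Base using (_∘_)
  open import Relation.Binary.PropositionalEquality
  open import Data.List.Relation.Unary.Any using (here; there)
  open LinearArithmetic hiding (lookup; absurd; head; tail)
  open Counting
  open Connections
  open Columns

  opaque
    unfolding size

    size-bits : ∀ a b c d e →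
      size (a ∷ b ∷ c ∷ d ∷ e ∷ []) ≡ bit a + (bit b + (bit c + (bit d + bit e)))
    size-bits a b c d e = refl

    size≤2 : ∀ {u} → Independent u → size u ≤ 2
    size≤2 {u} i with independent⇒∈ u i
    ... | here refl = z≤n
    ... | there (here refl) = s≤s z≤n
    ... | there (there (here refl)) = s≤s z≤n
    ... | there (there (there (here refl))) = s≤s z≤n
    ... | there (there (there (there (here refl)))) = s≤s z≤n
    ... | there (there (there (there (there (here refl))))) = s≤s z≤n
    ... | there (there (there (there (there (there i))))) = pairs i
      where
      pairs : ∀ {u} → u List.∈ drop 6 patterns → size u ≤ 2
      pairs (here refl) = ≤-refl
      pairs (there (here refl)) = ≤-refl
      pairs (there (there (here refl))) = ≤-refl
      pairs (there (there (there (here refl)))) = ≤-refl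
      pairs (there (there (there (there (here refl))))) = ≤-refl

  opaque
    unfolding size Forbid

    -- The two-element patterns are exactly the pairs of cyclically consecutive places, and the
    -- second hypothesis excludes these.
    size≤1 : ∀ {u} → Independent u → Forbid 1 u u → size u ≤ 1
    size≤1 {u} i f with independent⇒∈ u i
    ... | here refl = z≤n
    ... | there (here refl) = ≤-refl
    ... | there (there (here refl)) = ≤-refl
    ... | there (there (there (here refl))) = ≤-refl
    ... | there (there (there (there (here refl)))) = ≤-refl
    ... | there (there (there (there (there (here refl))))) = ≤-refl
    ... | there (there (there (there (there (there (here refl)))))) = ⊥-elim (f 1F refl refl)
    ... | there (there (there (there (there (there (there (here refl))))))) = ⊥-elim (f 2F refl refl)
    ... | there (there (there (there (there (there (there (there (here refl)))))))) = ⊥-elim (f 3F refl refl)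
    ... | there (there (there (there (there (there (there (there (there (here refl))))))))) = ⊥-elim (f 4F refl refl)
    ... | there (there (there (there (there (there (there (there (there (there (here refl)))))))))) = ⊥-elim (f 0F refl refl)

  conjunction : (Fin 5 → Formula) → Formula
  conjunction f = f 0F :∧ f 1F :∧ f 2F :∧ f 3F :∧ f 4F

  lookupAll : ∀ f {ρ} → ⟦ conjunction f ⟧ ρ → ∀ k → ⟦ f k ⟧ ρ
  lookupAll f (p , _)                 0F = p
  lookupAll f (_ , p , _)             1F = p
  lookupAll f (_ , _ , p , _)         2F = p
  lookupAll f (_ , _ , _ , p , _)     3F = p
  lookupAll f (_ , _ , _ , _ , p)     4F = p

  slot : ℕ → ℕ → Fin 5 → ℕ
  slot q i 0F = i
  slot q i 1F = i + q
  slot q i 2F = i + 2 * q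
  slot q i 3F = i + 3 * q
  slot q i 4F = i + 4 * q

  slotᵉ : Exp → Exp → Fin 5 → Exp
  slotᵉ g i 0F = i
  slotᵉ g i 1F = i :+ qᵉ g
  slotᵉ g i 2F = i :+ 2 :* qᵉ g
  slotᵉ g i 3F = i :+ 3 :* qᵉ g
  slotᵉ g i 4F = i :+ 4 :* qᵉ g

  slotᵉ-correct : ∀ g i k ρ → ⟦ slotᵉ g i k ⟧ᵉ ρ ≡ slot (⟦ qᵉ g ⟧ᵉ ρ) (⟦ i ⟧ᵉ ρ) k
  slotᵉ-correct g i 0F ρ = refl
  slotᵉ-correct g i 1F ρ = refl
  slotᵉ-correct g i 2F ρ = refl
  slotᵉ-correct g i 3F ρ = refl
  slotᵉ-correct g i 4F ρ = refl

  slot< : ∀ {g i} k → i < Arithmetic.q g → slot (Arithmetic.q g) i k < Arithmetic.n g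
  slot< {g} {i} k p = subst (_< Arithmetic.n g) (slotᵉ-correct x₁ x₀ k (i ∷ g ∷ [])) (lookupAll bounds {i ∷ g ∷ []} all< k)
    where
    bounds : Fin 5 → Formula
    bounds k = slotᵉ x₁ x₀ k :< nᵉ x₁
    all< : ⟦ conjunction bounds ⟧ (i ∷ g ∷ [])
    all< = linear (x₀ :< qᵉ x₁) (conjunction bounds) (i ∷ g ∷ []) refl p

  excluded : ℕ → Exp → Exp → Fin 5 → Formula
  excluded c a b k = edge x₂ (slotᵉ x₂ a (back c k)) (slotᵉ x₂ b k)

  forbidden : ℕ → Exp → Exp → Formula
  forbidden c a b = a :< qᵉ x₂ :∧ b :< qᵉ x₂ :∧ conjunction (excluded c a b)

  forbids : ℕ → Formula → Exp → Exp → Bool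
  forbids c φ a b = entails 3 φ (forbidden c a b)

  -- A place may be left out of a restricting cell only if 0 or q, both in the set, is adjacent to
  -- it.
  permitted : Bool → Exp → Exp → Formula
  permitted true  g a = :⊤
  permitted false g a = edge g (lit 0) a :∨ edge g (qᵉ g) a

  allowed : Cell → Exp → Fin 5 → Formula
  allowed A a k = permitted (A ! k) x₁ (slotᵉ x₁ a k)

  restricted : Cell → Exp → Formula
  restricted A a = a :< qᵉ x₁ :∧ conjunction (allowed A a)

  restricts : Cell → Formula → Exp → Bool
  restricts A φ a = entails 2 φ (restricted A a)

  module Positions (g : ℕ) (Q : ℕ → Bool) where
    open Arithmetic g

    cell : ℕ → Cell
    cell i = Q i ∷ Q (i + q) ∷ Q (i + 2 * q) ∷ Q (i + 3 * q) ∷ Q (i + 4 * q) ∷ []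

    cell-slot : ∀ i k → cell i ! k ≡ Q (slot q i k)
    cell-slot i 0F = refl
    cell-slot i 1F = refl
    cell-slot i 2F = refl
    cell-slot i 3F = refl
    cell-slot i 4F = refl

    -- The range is cut into five stretches of length q, and the coset of i takes the entry at i
    -- from each of them.
    sum-cells : sum n (bit ∘ Q) ≡ sum q (size ∘ cell)
    sum-cells = begin
      sum n f₀                                ≡⟨ cong (λ m → sum m f₀) n≡ ⟩
      sum (q + (q + (q + (q + q)))) f₀        ≡⟨ sum-split q _ f₀ ⟩
      F f₀ + sum (q + (q + (q + q))) f₁       ≡⟨ cong (F f₀ +_) (sum-split q _ f₁) ⟩
      F f₀ + (F f₁ + sum (q + (q + q)) f₂)    ≡⟨ cong (λ r → F f₀ + (F f₁ + r)) (sum-split q _ f₂) ⟩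
      F f₀ + (F f₁ + (F f₂ + sum (q + q) f₃)) ≡⟨ cong (λ r → F f₀ + (F f₁ + (F f₂ + r))) (sum-split q q f₃) ⟩
      F f₀ + (F f₁ + (F f₂ + (F f₃ + F f₄)))  ≡⟨ cong (λ r → F f₀ + (F f₁ + (F f₂ + r))) (sum-distrib q f₃ f₄) ⟨
      F f₀ + (F f₁ + (F f₂ + F g₃))           ≡⟨ cong (λ r → F f₀ + (F f₁ + r)) (sum-distrib q f₂ g₃) ⟨
      F f₀ + (F f₁ + F g₂)                    ≡⟨ cong (F f₀ +_) (sum-distrib q f₁ g₂) ⟨
      F f₀ + F g₁                             ≡⟨ sum-distrib q f₀ g₁ ⟨
      sum q (λ i → f₀ i + g₁ i)               ≡⟨ sum-cong q (λ {i} _ → trans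
        (cong (f₀ i +_) (cong₂ _+_ (cong f₀ (p₁ i)) (cong₂ _+_ (cong f₀ (p₂ i)) (cong₂ _+_ (cong f₀ (p₃ i)) (cong f₀ (p₄ i))))))
        (sym (size-bits (Q i) (Q (i + q)) (Q (i + 2 * q)) (Q (i + 3 * q)) (Q (i + 4 * q))))) ⟩
      sum q (size ∘ cell)                     ∎
      where
      open ≡-Reasoning
      F : (ℕ → ℕ) → ℕ
      F = sum q
      f₀ f₁ f₂ f₃ f₄ g₁ g₂ g₃ : ℕ → ℕ
      f₀ = bit ∘ Q
      f₁ i = f₀ (q + i)
      f₂ i = f₁ (q + i)
      f₃ i = f₂ (q + i)
      f₄ i = f₃ (q + i)
      g₃ i = f₃ i + f₄ i
      g₂ i = f₂ i + g₃ i
      g₁ i = f₁ i + g₂ i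
      n≡ : n ≡ q + (q + (q + (q + q)))
      n≡ = linear :⊤ (nᵉ x₀ :≡ qᵉ x₀ :+ (qᵉ x₀ :+ (qᵉ x₀ :+ (qᵉ x₀ :+ qᵉ x₀)))) (g ∷ []) refl tt
      p₁ : ∀ i → q + i ≡ i + q
      p₁ i = +-comm q i
      p₂ : ∀ i → q + (q + i) ≡ i + 2 * q
      p₂ i = linear :⊤ (x₀ :+ (x₀ :+ x₁) :≡ x₁ :+ 2 :* x₀) (q ∷ i ∷ []) refl tt
      p₃ : ∀ i → q + (q + (q + i)) ≡ i + 3 * q
      p₃ i = linear :⊤ (x₀ :+ (x₀ :+ (x₀ :+ x₁)) :≡ x₁ :+ 3 :* x₀) (q ∷ i ∷ []) refl tt
      p₄ : ∀ i → q + (q + (q + (q + i))) ≡ i + 4 * q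
      p₄ i = linear :⊤ (x₀ :+ (x₀ :+ (x₀ :+ (x₀ :+ x₁))) :≡ x₁ :+ 4 :* x₀) (q ∷ i ∷ []) refl tt

    u v : ℕ → Cell
    u i = cell i
    v i = cell (h + i)

    sum-total : ∀ m → total u v m ≡ sum m (λ i → size (u (suc i)) + size (v (suc i)))
    sum-total zero    = refl
    sum-total (suc m) = trans (cong (_+ (size (u (suc m)) + size (v (suc m)))) (sum-total m))
      (sym (sum-last m (λ i → size (u (suc i)) + size (v (suc i)))))

    sum-columns : sum q (size ∘ cell) ≡ size (cell 0) + total u v h
    sum-columns = cong (size (cell 0) +_) (begin
      sum (2 * h) f                    ≡⟨ cong (λ m → sum (h + m) f) (+-identityʳ h) ⟩
      sum (h + h) f                    ≡⟨ sum-split h h f ⟩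
      sum h f + sum h (λ i → f (h + i)) ≡⟨ cong (sum h f +_) (sum-cong h λ {i} _ → cong (size ∘ cell) (sym (+-suc h i))) ⟩
      sum h f + sum h f′               ≡⟨ sum-distrib h f f′ ⟨
      sum h (λ i → f i + f′ i)         ≡⟨ sum-total h ⟨
      total u v h                      ∎)
      where
      open ≡-Reasoning
      f f′ : ℕ → ℕ
      f i = size (u (suc i))
      f′ i = size (v (suc i))

    module _ (indep : ∀ {a b} → a < n → b < n → Edge a b → Q a ≡ true → Q b ≡ true → ⊥) where

      opaque
        unfolding Forbid

        -- The five edges of a matching form one formula in i, j and g, so a single test settles all
        -- pairs of cosets described by φ.
        forbid : ∀ c φ a b {i j} → forbids c φ a b ≡ true → ⟦ φ ⟧ (i ∷ j ∷ g ∷ []) →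
          Forbid c (cell (⟦ a ⟧ᵉ (i ∷ j ∷ g ∷ []))) (cell (⟦ b ⟧ᵉ (i ∷ j ∷ g ∷ [])))
        forbid c φ a b {i} {j} eq p k r r′ =
          let p₁ , p₂ , e = entails-sound 3 φ (forbidden c a b) (i ∷ j ∷ g ∷ []) eq p
              e′ = subst₂ Edge (slotᵉ-correct x₂ a (back c k) ρ) (slotᵉ-correct x₂ b k ρ) (lookupAll (excluded c a b) e k)
          in indep (slot< {g} (back c k) p₁) (slot< {g} k p₂) e′
            (trans (sym (cell-slot (⟦ a ⟧ᵉ ρ) (back c k))) r) (trans (sym (cell-slot (⟦ b ⟧ᵉ ρ) k)) r′)
          where
          ρ : Env
          ρ = i ∷ j ∷ g ∷ []

        pairless : ∀ {i} → (∀ k → Q (slot q i (prev k)) ≡ true → Q (slot q i k) ≡ true → ⊥) → Forbid 1 (cell i) (cell i)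
        pairless {i} f k r r′ = f k (trans (sym (cell-slot i (prev k))) r) (trans (sym (cell-slot i k)) r′)

      cell-independent : ∀ {i} → i < q → Independent (cell i)
      cell-independent {i} = forbid 2 (x₀ :< qᵉ x₂) x₀ x₀ {i} {0} refl

      no-pair⇒cell≤1 : ∀ {i} → i < q → (∀ k → Q (slot q i (prev k)) ≡ true → Q (slot q i k) ≡ true → ⊥) → size (cell i) ≤ 1
      no-pair⇒cell≤1 p f = size≤1 (cell-independent p) (pairless f)

      q<n : q < n
      q<n = linear :⊤ (qᵉ x₀ :< nᵉ x₀) (g ∷ []) refl tt

      module _ (Q0 : Q 0 ≡ true) (Qq : Q q ≡ true) where

        opaque
          unfolding _⊑_

          restrict : ∀ A φ a {i} → restricts A φ a ≡ true → ⟦ φ ⟧ (i ∷ g ∷ []) → cell (⟦ a ⟧ᵉ (i ∷ g ∷ [])) ⊑ A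
          restrict A φ a {i} eq p k r with A ! k in eq′
          ... | true  = refl
          ... | false =
            let p₁ , e = entails-sound 2 φ (restricted A a) (i ∷ g ∷ []) eq p
                e′ = subst (λ b → ⟦ permitted b x₁ (slotᵉ x₁ a k) ⟧ (i ∷ g ∷ [])) eq′ (lookupAll (allowed A a) e k)
                r′ = trans (sym (cell-slot (⟦ a ⟧ᵉ (i ∷ g ∷ [])) k)) r
                s  = slotᵉ-correct x₁ a k (i ∷ g ∷ [])
            in ⊥-elim (Sum.[
              (λ e → indep z<s (slot< {g} k p₁) (subst (Edge 0) s e) Q0 r′) ,
              (λ e → indep q<n (slot< {g} k p₁) (subst (Edge q) s e) Qq r′) ]′ e′)

        -- The indices of u i and v j differ by h + j - i, which decides the cases. In `vu` and
        -- `vu-wrap` the coset of u has the smaller index, so the shift from v to u is the negative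
        -- modulo 5: 4 in place of 1, and 1 in place of 4.
        word : Word h u v
        word = record
          { u-indep = λ {i} a b → forbid 2 inside x₀ x₀ {i} {0} refl (a , b)
          ; v-indep = λ {i} a b → forbid 2 inside (hᵉ x₂ :+ x₀) (hᵉ x₂ :+ x₀) {i} {0} refl (a , b)
          ; uu-near = λ a b c d → forbid 4 near x₀ x₁ refl (a , b , c , d)
          ; uu-far  = λ a b c → forbid 1 far x₀ x₁ refl (a , b , c)
          ; vv-near = λ a b c d → forbid 4 near (hᵉ x₂ :+ x₀) (hᵉ x₂ :+ x₁) refl (a , b , c , d)
          ; vv-far  = λ a b c → forbid 1 far (hᵉ x₂ :+ x₀) (hᵉ x₂ :+ x₁) refl (a , b , c)
          ; uv-same = λ {i} a b → forbid 3 inside x₀ (hᵉ x₂ :+ x₀) {i} {0} refl (a , b)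
          ; uv-next = λ {i} a b → forbid 1 (lit 1 :≤ x₀ :∧ x₀ :< hᵉ x₂) x₀ (hᵉ x₂ :+ (lit 1 :+ x₀)) {i} {0} refl (a , b)
          ; uv-far  = λ {i} {j} a b c d → forbid 3
              (lit 1 :≤ x₀ :∧ lit 2 :+ x₀ :≤ x₁ :∧ x₁ :≤ hᵉ x₂ :∧ lit 2 :+ x₁ :≤ x₀ :+ hᵉ x₂)
              x₀ (hᵉ x₂ :+ x₁) {i} {j} refl (a , b , c , d)
          ; uv-wrap = forbid 0 :⊤ (lit 1) (hᵉ x₂ :+ hᵉ x₂) {0} {0} refl tt
          ; vu      = λ {i} {j} a b c d → forbid 4
              (lit 1 :≤ x₀ :∧ x₀ :< x₁ :∧ x₁ :≤ hᵉ x₂ :∧ lit 3 :+ x₁ :≤ x₀ :+ hᵉ x₂)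
              (hᵉ x₂ :+ x₀) x₁ {i} {j} refl (a , b , c , d)
          ; vu-wrap = λ {i} {j} a b c d → forbid 1
              (lit 1 :≤ x₀ :∧ x₀ :< x₁ :∧ x₁ :≤ hᵉ x₂ :∧ x₀ :+ hᵉ x₂ :≤ lit 2 :+ x₁)
              (hᵉ x₂ :+ x₀) x₁ {i} {j} refl (a , b , c , d)
          ; u-start = λ a b → restrict startᵤ (lit 1 :≤ x₀ :∧ x₀ :≤ lit 2) x₀ refl (a , b)
          ; u-in    = λ a b → restrict inᵤ (lit 3 :≤ x₀ :∧ x₀ :< hᵉ x₁) x₀ refl (a , b)
          ; u-last  = restrict lastᵤ :⊤ (hᵉ x₁) {0} refl tt
          ; v-first = restrict firstᵥ :⊤ (hᵉ x₁ :+ lit 1) {0} refl tt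
          ; v-in    = λ {i} a b → restrict inᵥ (lit 2 :≤ x₀ :∧ lit 2 :+ x₀ :≤ hᵉ x₁) (hᵉ x₁ :+ x₀) {i} refl
              (a , b)
          ; v-end   = λ {i} a b → restrict endᵥ (x₀ :≤ hᵉ x₁ :∧ hᵉ x₁ :≤ lit 1 :+ x₀) (hᵉ x₁ :+ x₀) {i} refl
              (a , b)
          }
          where
          inside near far : Formula
          inside = lit 1 :≤ x₀ :∧ x₀ :≤ hᵉ x₂
          near = lit 1 :≤ x₀ :∧ x₀ :< x₁ :∧ x₁ :≤ lit 2 :+ x₀ :∧ x₁ :≤ hᵉ x₂
          far = lit 1 :≤ x₀ :∧ lit 3 :+ x₀ :≤ x₁ :∧ x₁ :≤ hᵉ x₂

        pair⇒sum≤ : sum n (bit ∘ Q) ≤ 2 + 2 * h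
        pair⇒sum≤ = begin
          sum n (bit ∘ Q)            ≡⟨ sum-cells ⟩
          sum q (size ∘ cell)        ≡⟨ sum-columns ⟩
          size (cell 0) + total u v h ≤⟨ +-mono-≤ (size≤2 (cell-independent z<s)) (Run.total≤ (m≤m+n 7 g) word) ⟩
          2 + 2 * h                  ∎
          where open ≤-Reasoning

      no-pair⇒sum≤ : (∀ {i} → i < n → Q i ≡ true → Q (i + q) ≡ true → ⊥) → (∀ i → Q (i + n) ≡ Q i) → sum n (bit ∘ Q) ≤ 2 + 2 * h
      no-pair⇒sum≤ f periodic = begin
        sum n (bit ∘ Q)      ≡⟨ sum-cells ⟩
        sum q (size ∘ cell)  ≤⟨ sum-mono q (λ {i} p → no-pair⇒cell≤1 p λ where
            -- The pair formed by the last and the first place wraps around: i + 4 q + q = i + n,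
            -- whence the periodicity of `Q`.
            0F r r′ → f (slot< {g} 4F p) r (trans (cong Q (e₄ i)) (trans (periodic i) r′))
            1F r r′ → f (slot< {g} 0F p) r r′
            2F r r′ → f (slot< {g} 1F p) r (trans (cong Q (e₁ i)) r′)
            3F r r′ → f (slot< {g} 2F p) r (trans (cong Q (e₂ i)) r′)
            4F r r′ → f (slot< {g} 3F p) r (trans (cong Q (e₃ i)) r′)) ⟩
        sum q (λ _ → 1)      ≡⟨ trans (sum-const q 1) (*-identityʳ q) ⟩
        q                    ≤⟨ n≤1+n q ⟩
        2 + 2 * h            ∎
        where
        open ≤-Reasoning
        e₁ : ∀ i → i + q + q ≡ i + 2 * q
        e₁ i = linear :⊤ (x₁ :+ x₀ :+ x₀ :≡ x₁ :+ 2 :* x₀) (q ∷ i ∷ []) refl tt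
        e₂ : ∀ i → i + 2 * q + q ≡ i + 3 * q
        e₂ i = linear :⊤ (x₁ :+ 2 :* x₀ :+ x₀ :≡ x₁ :+ 3 :* x₀) (q ∷ i ∷ []) refl tt
        e₃ : ∀ i → i + 3 * q + q ≡ i + 4 * q
        e₃ i = linear :⊤ (x₁ :+ 3 :* x₀ :+ x₀ :≡ x₁ :+ 4 :* x₀) (q ∷ i ∷ []) refl tt
        e₄ : ∀ i → i + 4 * q + q ≡ i + n
        e₄ i = linear :⊤ (x₁ :+ 4 :* qᵉ x₀ :+ qᵉ x₀ :≡ x₁ :+ nᵉ x₀) (g ∷ i ∷ []) refl tt

-- Independent sets created by deleting an edge

module Witnesses where

  open import Data.Bool.Base using (Bool; true; false; _∧_)
  open import Data.Unit.Base using (⊤; tt)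
  open import Data.Empty using (⊥)
  open import Data.List.Base using (List; []; _∷_)
  open import Data.Nat.Base
  open import Data.Nat.Properties
  open import Data.Product.Base using (_×_; _,_; proj₁; proj₂)
  open import Data.Sum.Base as Sum using (_⊎_; inj₁; inj₂)
  open import Function.Base using (_∘_; case_of_)
  open import Relation.Binary.PropositionalEquality
  open LinearArithmetic hiding (lookup; absurd; head; tail)
  open Counting
  open Connections

  -- A run (a , l) skips a numbers and then takes the next l.
  Runs : Set
  Runs = List (ℕ × ℕ)

  member : Runs → ℕ → Bool
  member []                     w       = false
  member ((zero  , zero)  ∷ rs) w       = member rs w
  member ((zero  , suc l) ∷ rs) zero    = true
  member ((zero  , suc l) ∷ rs) (suc w) = member ((zero , l) ∷ rs) w
  member ((suc a , l)     ∷ rs) zero    = false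
  member ((suc a , l)     ∷ rs) (suc w) = member ((a , l) ∷ rs) w

  -- The same set in absolute positions, with c the place where the remaining runs begin. Unlike
  -- `member` it unfolds to linear inequalities even when the run lengths are symbolic.
  Member : Runs → ℕ → ℕ → Set
  Member []             c w = ⊥
  Member ((a , l) ∷ rs) c w = (c + a ≤ w × w < c + a + l) ⊎ Member rs (c + a + l) w

  member-sound : ∀ rs c w → member rs w ≡ true → Member rs c (c + w)
  member-sound ((zero  , zero)  ∷ rs) c w e =
    inj₂ (subst (λ d → Member rs d (c + w)) (sym (trans (+-identityʳ (c + 0)) (+-identityʳ c))) (member-sound rs c w e))
  member-sound ((zero  , suc l) ∷ rs) c zero    e =
    inj₁ (≤-refl , m<m+n (c + 0) z<s)
  member-sound ((zero  , suc l) ∷ rs) c (suc w) e with member-sound ((zero , l) ∷ rs) (suc c) w e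
  ... | inj₁ (p , p′) = inj₁ (≤-trans p′′ (≤-reflexive (sym (+-suc c w))) , subst₂ _<_ (sym (+-suc c w)) (sym (+-suc (c + 0) l)) p′)
    where p′′ = ≤-trans (n≤1+n (c + 0)) p
  ... | inj₂ p = inj₂ (subst₂ (Member rs) (sym (+-suc (c + 0) l)) (sym (+-suc c w)) p)
  member-sound ((suc a , l)     ∷ rs) c (suc w) e with member-sound ((a , l) ∷ rs) (suc c) w e
  ... | inj₁ (p , p′) = inj₁ (subst₂ _≤_ (sym (+-suc c a)) (sym (+-suc c w)) p ,
        subst₂ _<_ (sym (+-suc c w)) (cong (_+ l) (sym (+-suc c a))) p′)
  ... | inj₂ p = inj₂ (subst₂ (Member rs) (cong (_+ l) (sym (+-suc c a))) (sym (+-suc c w)) p)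

  length span : Runs → ℕ
  length []             = 0
  length ((a , l) ∷ rs) = l + length rs
  span []             = 0
  span ((a , l) ∷ rs) = a + (l + span rs)

  sum-member : ∀ rs m → sum (span rs + m) (bit ∘ member rs) ≡ length rs
  sum-member []                     m = trans (sum-const m 0) (*-zeroʳ m)
  sum-member ((zero  , zero)  ∷ rs) m = sum-member rs m
  sum-member ((zero  , suc l) ∷ rs) m = cong suc (sum-member ((zero , l) ∷ rs) m)
  sum-member ((suc a , l)     ∷ rs) m = sum-member ((a , l) ∷ rs) m

  Runsᵉ : Set
  Runsᵉ = List (Exp × Exp)

  ⟦_⟧ʳ : Runsᵉ → Env → Runs
  ⟦ []           ⟧ʳ ρ = []
  ⟦ (a , l) ∷ rs ⟧ʳ ρ = (⟦ a ⟧ᵉ ρ , ⟦ l ⟧ᵉ ρ) ∷ ⟦ rs ⟧ʳ ρ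

  memberᵉ : Runsᵉ → Exp → Exp → Formula
  memberᵉ []             c w = :⊥
  memberᵉ ((a , l) ∷ rs) c w = (c :+ a :≤ w :∧ w :< c :+ a :+ l) :∨ memberᵉ rs (c :+ a :+ l) w

  lengthᵉ spanᵉ : Runsᵉ → Exp
  lengthᵉ []             = lit 0
  lengthᵉ ((a , l) ∷ rs) = l :+ lengthᵉ rs
  spanᵉ []             = lit 0
  spanᵉ ((a , l) ∷ rs) = a :+ (l :+ spanᵉ rs)

  member⇒ᵉ : ∀ rs c w ρ → Member (⟦ rs ⟧ʳ ρ) (⟦ c ⟧ᵉ ρ) (⟦ w ⟧ᵉ ρ) → ⟦ memberᵉ rs c w ⟧ ρ
  member⇒ᵉ ((a , l) ∷ rs) c w ρ (inj₁ p) = inj₁ p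
  member⇒ᵉ ((a , l) ∷ rs) c w ρ (inj₂ p) = inj₂ (member⇒ᵉ rs (c :+ a :+ l) w ρ p)

  lengthᵉ-correct : ∀ rs ρ → length (⟦ rs ⟧ʳ ρ) ≡ ⟦ lengthᵉ rs ⟧ᵉ ρ
  lengthᵉ-correct []             ρ = refl
  lengthᵉ-correct ((a , l) ∷ rs) ρ = cong (⟦ l ⟧ᵉ ρ +_) (lengthᵉ-correct rs ρ)

  spanᵉ-correct : ∀ rs ρ → span (⟦ rs ⟧ʳ ρ) ≡ ⟦ spanᵉ rs ⟧ᵉ ρ
  spanᵉ-correct []             ρ = refl
  spanᵉ-correct ((a , l) ∷ rs) ρ = cong (λ s → ⟦ a ⟧ᵉ ρ + (⟦ l ⟧ᵉ ρ + s)) (spanᵉ-correct rs ρ)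

  -- Renumbers the variables to make room for two new ones.
  ↑_ : Exp → Exp
  ↑ var i    = var (2 + i)
  ↑ lit k    = lit k
  ↑ (a :+ b) = ↑ a :+ ↑ b
  ↑ (k :* a) = k :* (↑ a)

  ↑-correct : ∀ e {w w′} ρ → ⟦ ↑ e ⟧ᵉ (w ∷ w′ ∷ ρ) ≡ ⟦ e ⟧ᵉ ρ
  ↑-correct (var i)  ρ = refl
  ↑-correct (lit k)  ρ = refl
  ↑-correct (a :+ b) ρ = cong₂ _+_ (↑-correct a ρ) (↑-correct b ρ)
  ↑-correct (k :* a) ρ = cong (k *_) (↑-correct a ρ)

  ↑ʳ_ : Runsᵉ → Runsᵉ
  ↑ʳ []             = []
  ↑ʳ ((a , l) ∷ rs) = (↑ a , ↑ l) ∷ (↑ʳ rs)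

  ↑ʳ-correct : ∀ rs {w w′} ρ → ⟦ ↑ʳ rs ⟧ʳ (w ∷ w′ ∷ ρ) ≡ ⟦ rs ⟧ʳ ρ
  ↑ʳ-correct []             ρ = refl
  ↑ʳ-correct ((a , l) ∷ rs) ρ =
    cong₂ _∷_ (cong₂ _,_ (↑-correct a ρ) (↑-correct l ρ)) (↑ʳ-correct rs ρ)

  -- The pair (a , b) stands for a ≤ b.
  Hypotheses : Set
  Hypotheses = List (Exp × Exp)

  ⟦_⟧ʰ : Hypotheses → Env → Set
  ⟦ []          ⟧ʰ ρ = ⊤
  ⟦ (a , b) ∷ φ ⟧ʰ ρ = ⟦ a ⟧ᵉ ρ ≤ ⟦ b ⟧ᵉ ρ × ⟦ φ ⟧ʰ ρ

  formula formula↑ : Hypotheses → Formula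
  formula []            = :⊤
  formula ((a , b) ∷ φ) = a :≤ b :∧ formula φ
  formula↑ []            = :⊤
  formula↑ ((a , b) ∷ φ) = ↑ a :≤ ↑ b :∧ formula↑ φ

  formula-correct : ∀ φ ρ → ⟦ φ ⟧ʰ ρ → ⟦ formula φ ⟧ ρ
  formula-correct []            ρ h       = tt
  formula-correct ((a , b) ∷ φ) ρ (p , h) = p , formula-correct φ ρ h

  formula↑-correct : ∀ φ {w w′} ρ → ⟦ φ ⟧ʰ ρ → ⟦ formula↑ φ ⟧ (w ∷ w′ ∷ ρ)
  formula↑-correct []            ρ h       = tt
  formula↑-correct ((a , b) ∷ φ) ρ (p , h) =
    subst₂ _≤_ (sym (↑-correct a ρ)) (sym (↑-correct b ρ)) p , formula↑-correct φ ρ h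

  module Deletion (g : ℕ) where
    open Arithmetic g

    -- A set of residues that is independent but for the edge {0 , d}.
    record Witness (d : ℕ) : Set where
      field
        runs   : Runs
        order≡ : length runs ≡ 3 + 2 * h
        fits   : span runs ≤ n
        only   : ∀ {w w′} → Member runs 0 w → Member runs 0 w′ → Link w w′ → w ≡ 0 × w′ ≡ d

    -- The sizes are checked in the parameters g, k, m. For independence the two elements w and w′
    -- come in front of these, which is why everything else is renumbered by `↑`.
    certifies : Hypotheses → Runsᵉ → Exp → Bool
    certifies φ rs d =
      entails 3 (formula φ) (lengthᵉ rs :≡ lit 3 :+ 2 :* hᵉ x₀ :∧ spanᵉ rs :≤ nᵉ x₀) ∧
      entails 5 (formula↑ φ :∧ memberᵉ (↑ʳ rs) (lit 0) x₀ :∧ memberᵉ (↑ʳ rs) (lit 0) x₁ :∧ link x₂ x₀ x₁)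
        (x₀ :≡ lit 0 :∧ x₁ :≡ ↑ d)

    certified : ∀ φ rs d {k m} → certifies φ rs d ≡ true → ⟦ φ ⟧ʰ (g ∷ k ∷ m ∷ []) → Witness (⟦ d ⟧ᵉ (g ∷ k ∷ m ∷ []))
    certified φ rs d {k} {m} eq p with ∧-true _ _ eq
    ... | eq₁ , eq₂ = record
      { runs   = ⟦ rs ⟧ʳ ρ
      ; order≡ = trans (lengthᵉ-correct rs ρ) (proj₁ sizes)
      ; fits   = subst (_≤ n) (sym (spanᵉ-correct rs ρ)) (proj₂ sizes)
      ; only   = only′
      }
      where
      ρ : Env
      ρ = g ∷ k ∷ m ∷ []

      sizes : ⟦ lengthᵉ rs ⟧ᵉ ρ ≡ 3 + 2 * h × ⟦ spanᵉ rs ⟧ᵉ ρ ≤ n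
      sizes = entails-sound 3 (formula φ) (lengthᵉ rs :≡ lit 3 :+ 2 :* hᵉ x₀ :∧ spanᵉ rs :≤ nᵉ x₀) ρ eq₁
        (formula-correct φ ρ p)

      only′ : ∀ {w w′} → Member (⟦ rs ⟧ʳ ρ) 0 w → Member (⟦ rs ⟧ʳ ρ) 0 w′ → Link w w′ → w ≡ 0 × w′ ≡ ⟦ d ⟧ᵉ ρ
      only′ {w} {w′} i j l with entails-sound 5
        (formula↑ φ :∧ memberᵉ (↑ʳ rs) (lit 0) x₀ :∧ memberᵉ (↑ʳ rs) (lit 0) x₁ :∧ link x₂ x₀ x₁)
        (x₀ :≡ lit 0 :∧ x₁ :≡ ↑ d) (w ∷ w′ ∷ ρ) eq₂
        (formula↑-correct φ ρ p , lift x₀ i , lift x₁ j , l)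
        where
        lift : ∀ x → Member (⟦ rs ⟧ʳ ρ) 0 (⟦ x ⟧ᵉ (w ∷ w′ ∷ ρ)) → ⟦ memberᵉ (↑ʳ rs) (lit 0) x ⟧ (w ∷ w′ ∷ ρ)
        lift x i = member⇒ᵉ (↑ʳ rs) (lit 0) x (w ∷ w′ ∷ ρ)
          (subst (λ r → Member r 0 (⟦ x ⟧ᵉ (w ∷ w′ ∷ ρ))) (sym (↑ʳ-correct rs ρ)) i)
      ... | e , e′ = e , trans e′ (↑-correct d ρ)

    -- The case d = 2 h - 1. In the run lengths here and below, 4 + g, 5 + g and 6 + g are h - 3, h
    -- - 2 and h - 1, while 25 + 4 g and 26 + 4 g are 4 h - 3 and 4 h - 2.
    witness₁ : Witness (13 + 2 * g)
    witness₁ = certified []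
      ((lit 0 , lit 1) ∷ (lit 4 :+ x₀ , lit 6 :+ x₀) ∷ (lit 2 , lit 1) ∷ (lit 1 , lit 1) ∷ (lit 25 :+ 4 :* x₀ , lit 2) ∷
       (lit 1 , lit 1) ∷ (lit 1 , lit 4 :+ x₀) ∷ (lit 2 :+ 3 :* hᵉ x₀ , lit 1) ∷ [])
      (lit 13 :+ 2 :* x₀) {0} {0} refl tt

    -- Written out, the set is {0} ∪ [h , 2 h - 2] ∪ [2 h , 2 h + 3] ∪ {6 h + 1} ∪
    -- [6 h + 6 , 7 h + 2] ∪ {8 h + 2}. Its nonzero elements other than 2 h lie in the gaps of C.
    witness₂ : Witness (2 * h)
    witness₂ = certified []
      ((lit 0 , lit 1) ∷ (lit 6 :+ x₀ , lit 6 :+ x₀) ∷ (lit 1 , lit 4) ∷ (lit 25 :+ 4 :* x₀ , lit 1) ∷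
       (lit 4 , lit 4 :+ x₀) ∷ (lit 6 :+ x₀ , lit 1) ∷ [])
      (2 :* hᵉ x₀) {0} {0} refl tt

    -- The interval q + 3 ≤ d ≤ 3 h amounts to 0 ≤ k ≤ g + 3. Some run lengths shrink as k grows;
    -- the companion m, with k + m fixed, expresses them without subtraction. Three shapes are used:
    -- for the lower end, the middle and the upper end of the interval.
    witness₃ : ∀ k m → k ≤ 1 → k + m ≡ 1 + g → Witness (q + (3 + k))
    witness₃ k m p e = certified ((x₁ , lit 1) ∷ (x₁ :+ x₂ , lit 1 :+ x₀) ∷ (lit 1 :+ x₀ , x₁ :+ x₂) ∷ [])
      ((lit 0 , lit 1) ∷ (lit 2 :+ x₁ , lit 1) ∷ (lit 2 :+ x₂ , lit 6 :+ x₀) ∷ (lit 2 , lit 1 :+ x₁) ∷ (lit 2 , lit 1) ∷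
       (lit 2 :+ 3 :* hᵉ x₀ :+ x₂ , lit 2) ∷ (lit 1 :+ x₁ , lit 2) ∷ (lit 1 , lit 2 :+ x₂) ∷ [])
      (qᵉ x₀ :+ (lit 3 :+ x₁)) refl (p , ≤-reflexive e , ≤-reflexive (sym e) , tt)

    witness₄ : ∀ k m → 2 ≤ k → k + m ≡ 1 + g → Witness (q + (3 + k))
    witness₄ k m p e = certified ((lit 2 , x₁) ∷ (x₁ :+ x₂ , lit 1 :+ x₀) ∷ (lit 1 :+ x₀ , x₁ :+ x₂) ∷ [])
      ((lit 0 , lit 1) ∷ (qᵉ x₀ :+ (lit 2 :+ x₁) , lit 1) ∷ (lit 6 :+ x₀ , lit 4 :+ x₂) ∷ (lit 1 , x₁) ∷ (lit 2 , lit 3) ∷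
       (lit 2 :+ 3 :* hᵉ x₀ :+ x₂ , lit 1) ∷ (x₁ , lit 2) ∷ (lit 3 , lit 4 :+ x₀) ∷ [])
      (qᵉ x₀ :+ (lit 3 :+ x₁)) refl (p , ≤-reflexive e , ≤-reflexive (sym e) , tt)

    witness₅ : ∀ k m → m ≤ 1 → k + m ≡ 3 + g → Witness (q + (3 + k))
    witness₅ k m p e = certified ((x₂ , lit 1) ∷ (x₁ :+ x₂ , lit 3 :+ x₀) ∷ (lit 3 :+ x₀ , x₁ :+ x₂) ∷ [])
      ((lit 0 , lit 1) ∷ (qᵉ x₀ :+ (lit 2 :+ x₁) , lit 1) ∷ (lit 6 :+ x₀ , lit 2 :+ x₂) ∷ (lit 1 , x₁) ∷
       (lit 2 , lit 1 :+ x₂) ∷ (lit 2 :+ 3 :* hᵉ x₀ , lit 1) ∷ (x₁ , lit 2) ∷ (lit 1 :+ x₂ , lit 3 :+ x₁) ∷ [])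
      (qᵉ x₀ :+ (lit 3 :+ x₁)) refl (p , ≤-reflexive e , ≤-reflexive (sym e) , tt)

    witness₆ : Witness (2 + 3 * h)
    witness₆ = certified []
      ((lit 0 , lit 1) ∷ (qᵉ x₀ , lit 2) ∷ (lit 5 :+ x₀ , lit 6 :+ x₀) ∷ (lit 3 , lit 2) ∷ (lit 25 :+ 4 :* x₀ , lit 2) ∷
       (lit 3 , lit 4 :+ x₀) ∷ [])
      (lit 2 :+ 3 :* hᵉ x₀) {0} {0} refl tt

    witness₇ : Witness (2 * q)
    witness₇ = certified []
      ((lit 0 , lit 1) ∷ (lit 26 :+ 4 :* x₀ , lit 2) ∷ (lit 1 , lit 6 :+ x₀) ∷ (lit 2 :+ 3 :* hᵉ x₀ , lit 1) ∷
       (lit 6 :+ x₀ , lit 6 :+ x₀) ∷ (lit 2 , lit 1) ∷ [])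
      (2 :* qᵉ x₀) {0} {0} refl tt

    witness : ∀ d → Link 0 d → d ≤ 2 * q → Witness d
    witness d l d≤ =
      case linear (link x₁ (lit 0) x₀ :∧ x₀ :≤ 2 :* qᵉ x₁)
          (lit 13 :+ 2 :* x₁ :≡ x₀ :∨ 2 :* hᵉ x₁ :≡ x₀ :∨ (qᵉ x₁ :+ lit 3 :≤ x₀ :∧ x₀ :≤ 3 :* hᵉ x₁) :∨
           lit 2 :+ 3 :* hᵉ x₁ :≡ x₀ :∨ 2 :* qᵉ x₁ :≡ x₀) (d ∷ g ∷ []) refl (l , d≤) of λ where
        (inj₁ e)                             → subst Witness e witness₁
        (inj₂ (inj₁ e))                      → subst Witness e witness₂
        (inj₂ (inj₂ (inj₁ (p , p′))))        → middle p p′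
        (inj₂ (inj₂ (inj₂ (inj₁ e))))        → subst Witness e witness₆
        (inj₂ (inj₂ (inj₂ (inj₂ e))))        → subst Witness e witness₇
      where
      middle : q + 3 ≤ d → d ≤ 3 * h → Witness d
      middle p p′ = subst Witness (trans (sym (+-assoc q 3 k)) (m+[n∸m]≡n p)) (go (≤-<-connex k 1) (≤-<-connex k (1 + g)))
        where
        k : ℕ
        k = d ∸ (q + 3)

        k≤ : k ≤ 3 + g
        k≤ = linear (x₀ :+ (qᵉ x₂ :+ lit 3) :≡ x₁ :∧ x₁ :≤ 3 :* hᵉ x₂) (x₀ :≤ lit 3 :+ x₂)
          (k ∷ d ∷ g ∷ []) refl (m∸n+n≡m p , p′)

        go : k ≤ 1 ⊎ 1 < k → k ≤ 1 + g ⊎ 1 + g < k → Witness (q + (3 + k))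
        go (inj₁ s) _        = witness₃ k (1 + g ∸ k) s (m+[n∸m]≡n (≤-trans s (s≤s z≤n)))
        go (inj₂ s) (inj₁ r) = witness₄ k (1 + g ∸ k) s (m+[n∸m]≡n r)
        go (inj₂ s) (inj₂ r) = witness₅ k (3 + g ∸ k)
          (linear (x₀ :+ x₁ :≡ lit 3 :+ x₂ :∧ lit 1 :+ x₂ :< x₀) (x₁ :≤ lit 1) (k ∷ 3 + g ∸ k ∷ g ∷ []) refl
            (m+[n∸m]≡n k≤ , r))
          (m+[n∸m]≡n k≤)

open import Data.List.Base using ([]; _∷_)
open import Data.Unit.Base using (tt)
open import Data.Bool.Base using (Bool; true)
import Data.Bool.Properties as Bool
open import Data.Empty using (⊥; ⊥-elim)
open import Data.Fin.Base using (Fin; zero; suc; toℕ)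
open import Data.Fin.Properties using (toℕ<n; toℕ-injective; any?)
open import Data.Fin.Subset using (Subset; _∈_; ∣_∣)
open import Data.Fin.Subset.Properties using (∉⊥; ∣⊥∣≡0; _∈?_)
import Data.Fin.Subset as Subset
open import Data.Nat.Base
open import Data.Nat.DivMod using (_%_; _/_; m*n/n≡m; m≡m%n+[m/n]*n)
open import Data.Nat.Properties
open import Data.Product.Base using (∃-syntax; _×_; _,_; proj₁; proj₂; map₂; swap)
open import Data.Sum.Base as Sum using (_⊎_; inj₁; inj₂)
open import Data.Vec.Base using (lookup; tabulate)
open import Data.Vec.Properties using (lookup⇒[]=; []=⇒lookup; lookup∘tabulate)
open import Function.Base using (_∘_; case_of_)
open import Relation.Binary.PropositionalEquality
open import Relation.Nullary using (¬_; Dec; yes; no; contradiction; _×-dec_)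
open LinearArithmetic hiding (lookup; absurd; head; tail)
open Counting
open Connections
open Traces
open Witnesses

-- The four properties for a graph on Fin n with connection set C

module Saturation (g : ℕ) (G : Graph (5 + 10 * (7 + g)))
  (adj⇒ : ∀ {x y} → Adj G x y → Arithmetic.Edge g (toℕ x) (toℕ y))
  (adj⇐ : ∀ {x y} → Arithmetic.Edge g (toℕ x) (toℕ y) → Adj G x y) where

  open Arithmetic g
  open Deletion g using (module Witness; Witness; witness)
  open Cyclic n

  triangle-free : TriangleFree G
  triangle-free (x , y , z , xy , yz , xz) = no-triangle (adj⇒ xy) (adj⇒ yz) (adj⇒ xz)

  position : ∀ x {w} → w < n → Shift (toℕ x) w (toℕ (at x w))
  position x p = at-shift x p , toℕ<n _ , p

  position-0 : ∀ x → Shift (toℕ x) 0 (toℕ x)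
  position-0 x = inj₁ (+-identityʳ (toℕ x)) , toℕ<n x , z<s

  offset-shift : ∀ x y → Shift (toℕ x) (offset x y) (toℕ y)
  offset-shift x y = subst (λ z → Shift (toℕ x) (offset x y) (toℕ z)) (at-offset x y) (position x (offset< x y))

  offset-swap : ∀ {x y} → x ≢ y → offset x y + offset y x ≡ n
  offset-swap {x} {y} x≢y = shift-swap (x≢y ∘ toℕ-injective) (offset-shift x y) (offset-shift y x)

  common-adjacent : ∀ {x y} → x ≢ y → ¬ Adj G x y → ∃[ z ] Adj G x z × Adj G z y
  common-adjacent {x} {y} x≢y ¬xy = Sum.[ near x≢y ¬xy , far ]′ (≤-<-connex (offset x y) (2 + 5 * h))
    where
    transport : ∀ {x y} → ∃[ c ] c < n × Edge 0 c × Edge c (offset x y) → ∃[ z ] Adj G x z × Adj G z y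
    transport {x} {y} (c , c<n , e , e′) = at x c ,
      adj⇐ (edge-shift (position-0 x) (position x c<n) e) ,
      adj⇐ (edge-shift (position x c<n) (offset-shift x y) e′)

    near : ∀ {x y} → x ≢ y → ¬ Adj G x y → offset x y ≤ 2 + 5 * h → ∃[ z ] Adj G x z × Adj G z y
    near {x} {y} x≢y ¬xy p = transport (common-neighbour (offset x y) (offset-positive x≢y) p
      (λ e → ¬xy (adj⇐ (edge-shift (position-0 x) (offset-shift x y) e))))

    reverse : ∃[ z ] Adj G y z × Adj G z x → ∃[ z ] Adj G x z × Adj G z y
    reverse (z , yz , zx) = z , Graph.adj-sym G zx , Graph.adj-sym G yz

    far : 2 + 5 * h < offset x y → ∃[ z ] Adj G x z × Adj G z y
    far p = reverse (near (≢-sym x≢y) (¬xy ∘ Graph.adj-sym G) (half (offset-swap x≢y) p))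
      where
      half : ∀ {w v} → w + v ≡ n → 2 + 5 * h < w → v ≤ 2 + 5 * h
      half {w} {v} e p = linear (x₀ :+ x₁ :≡ nᵉ x₂ :∧ lit 2 :+ 5 :* hᵉ x₂ :< x₀) (x₁ :≤ lit 2 :+ 5 :* hᵉ x₂)
        (w ∷ v ∷ g ∷ []) refl (e , p)

  addEdge-triangle : ∀ x y (x≢y : x ≢ y) → ¬ Adj G x y → HasTriangle (addEdge G x y x≢y)
  addEdge-triangle x y x≢y ¬xy =
    let z , xz , zy = common-adjacent x≢y ¬xy
    in x , z , y , inj₁ xz , inj₁ zy , inj₂ (inj₁ (refl , refl))

  independent-order : ∀ p → IsIndependent G p → ∣ p ∣ ≤ 2 + 2 * h
  independent-order p ind = bound (any? (λ x → (x ∈? p) ×-dec (at x q ∈? p)))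
    where
    Q : Fin n → ℕ → Bool
    Q x w = lookup p (at x w)

    indep : ∀ x {a b} → a < n → b < n → Edge a b → Q x a ≡ true → Q x b ≡ true → ⊥
    indep x {a} {b} a< b< e r r′ = ind (lookup⇒[]= (at x a) p r) (lookup⇒[]= (at x b) p r′)
      (adj⇐ (edge-shift (position x a<) (position x b<) e))

    bound : Dec (∃[ x ] x ∈ p × at x q ∈ p) → ∣ p ∣ ≤ 2 + 2 * h
    bound (yes (x , i , j)) = ≤-trans (≤-reflexive (card-at p x))
      (Positions.pair⇒sum≤ g (Q x) (indep x)
        (trans (cong (lookup p) (at-0 x)) ([]=⇒lookup i)) ([]=⇒lookup j))
    bound (no ∄) = ≤-trans (≤-reflexive (card-at p zero))
      (Positions.no-pair⇒sum≤ g (Q zero) (indep zero)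
        (λ {i} _ r r′ → ∄ (at zero i , lookup⇒[]= (at zero i) p r ,
          subst (_∈ p) (sym (at-at zero i q)) (lookup⇒[]= (at zero (i + q)) p r′)))
        (λ i → cong (lookup p) (at-+n zero i)))

  deleteEdge-near : ∀ x y → Link 0 (offset x y) → offset x y ≤ 2 * q →
    HasIndependentSet (3 + 2 * h) (deleteEdge G x y)
  deleteEdge-near x y l d≤ = p , independent , card-p
    where
    open Witness (witness (offset x y) l d≤)

    p : Subset n
    p = tabulate (λ v → member runs (offset x v))

    card-p : ∣ p ∣ ≡ 3 + 2 * h
    card-p = begin
      ∣ p ∣                                          ≡⟨ card-at p x ⟩
      sum n (λ w → bit (lookup p (at x w)))          ≡⟨ sum-cong n (λ {w} w<n → cong bit
        (trans (lookup∘tabulate (λ v → member runs (offset x v)) (at x w)) (cong (member runs) (offset-at x w<n)))) ⟩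
      sum n (bit ∘ member runs)                      ≡⟨ cong (λ m → sum m (bit ∘ member runs)) (m+[n∸m]≡n fits) ⟨
      sum (span runs + (n ∸ span runs)) (bit ∘ member runs) ≡⟨ sum-member runs _ ⟩
      length runs                                    ≡⟨ order≡ ⟩
      3 + 2 * h                                      ∎
      where open ≡-Reasoning

    ∈⇒Member : ∀ {v} → v ∈ p → Member runs 0 (offset x v)
    ∈⇒Member {v} i = member-sound runs 0 (offset x v)
      (trans (sym (lookup∘tabulate (λ v → member runs (offset x v)) v)) ([]=⇒lookup i))

    endpoints : ∀ {v v′} → offset x v ≡ 0 × offset x v′ ≡ offset x y → v ≡ x × v′ ≡ y
    endpoints {v} {v′} (e , e′) =
      trans (sym (at-offset x v)) (trans (cong (at x) e) (at-0 x)) ,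
      trans (sym (at-offset x v′)) (trans (cong (at x) e′) (at-offset x y))

    independent : IsIndependent (deleteEdge G x y) p
    independent {v} {v′} i j (a , ≠) = Sum.[
      (λ k → ≠ (inj₁ (endpoints (only (∈⇒Member i) (∈⇒Member j) k)))) ,
      (λ k → ≠ (inj₂ (swap (endpoints (only (∈⇒Member j) (∈⇒Member i) k))))) ]′
      (shift-edge (offset-shift x v) (offset-shift x v′) (adj⇒ a))

  deleteEdge-comm : ∀ {x y t} → HasIndependentSet t (deleteEdge G x y) → HasIndependentSet t (deleteEdge G y x)
  deleteEdge-comm (p , ind , c) = p , (λ i j (a , ≠) → ind i j (a , ≠ ∘ Sum.swap)) , c

  deleteEdge-independent : ∀ x y → Adj G x y → HasIndependentSet (3 + 2 * h) (deleteEdge G x y)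
  deleteEdge-independent x y xy = Sum.[ deleteEdge-near x y linked , far ]′ (≤-<-connex (offset x y) (2 * q))
    where
    linked : Link 0 (offset x y)
    linked = Sum.[ (λ l → l) , (λ l → contradiction (link⇒< l) λ ()) ]′
      (shift-edge (position-0 x) (offset-shift x y) (adj⇒ xy))

    e : offset x y + offset y x ≡ n
    e = offset-swap λ x≡y → Graph.adj-irrefl G x≡y xy

    far : 2 * q < offset x y → HasIndependentSet (3 + 2 * h) (deleteEdge G x y)
    far p = deleteEdge-comm (deleteEdge-near y x
      (link-complement e linked) (far≤ e linked p))
      where
      far≤ : ∀ {w v} → w + v ≡ n → Link 0 w → 2 * q < w → v ≤ 2 * q
      far≤ {w} {v} e l p = linear (x₀ :+ x₁ :≡ nᵉ x₂ :∧ link x₂ (lit 0) x₀ :∧ 2 :* qᵉ x₂ :< x₀) (x₁ :≤ 2 :* qᵉ x₂)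
        (w ∷ v ∷ g ∷ []) refl (e , l , p)

  -- The lower bound is a by-product of edge deletion: an independent set of order t in G minus an
  -- edge, with one endpoint removed, is independent in G. The edge {0 , 2 h} is just a convenient
  -- choice.
  Independence : IndependenceNumber G (2 + 2 * h)
  Independence = drop-endpoint (deleteEdge-independent zero (at zero (2 * h)) zero-edge) , independent-order
    where
    zero-edge : Adj G zero (at zero (2 * h))
    zero-edge = adj⇐ (edge-shift (position-0 zero)
      (position zero {2 * h} (linear :⊤ (2 :* hᵉ x₀ :< nᵉ x₀) (g ∷ []) refl tt))
      (inj₁ (linear :⊤ (link x₀ (lit 0) (2 :* hᵉ x₀)) (g ∷ []) refl tt)))

    drop-endpoint : ∀ {x y} → HasIndependentSet (3 + 2 * h) (deleteEdge G x y) → HasIndependentSet (2 + 2 * h) G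
    drop-endpoint {x} {y} (p , ind , c) = drop (x ∈? p)
      where
      drop : Dec (x ∈ p) → HasIndependentSet (2 + 2 * h) G
      drop (yes i) = let r , c′ , f = remove i c in
        r , (λ j k a → ind (proj₁ (f j)) (proj₁ (f k))
          (a , Sum.[ (λ (e , _) → proj₂ (f j) e) , (λ (_ , e) → proj₂ (f k) e) ]′)) , c′
      -- If x is not in p, then p does not contain the deleted edge, and any vertex may be dropped
      -- to reach the required order.
      drop (no ∉) = let r , c′ , f = remove (proj₂ (pick p c)) c in
        r , (λ j k a → ind (proj₁ (f j)) (proj₁ (f k))
          (a , Sum.[ (λ (e , _) → ∉ (subst (_∈ p) e (proj₁ (f j)))) ,
                     (λ (_ , e) → ∉ (subst (_∈ p) e (proj₁ (f k)))) ]′)) , c′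

-- Triangles and cliques of order 3

module _ {m : ℕ} (G : Graph m) where

  clique⇒triangle : HasClique 3 G → HasTriangle G
  clique⇒triangle (p , cl , c)
    with x , i ← pick p c with p₁ , c₁ , f₁ ← remove i c
    with y , j ← pick p₁ c₁ with p₂ , c₂ , f₂ ← remove j c₁
    with z , k ← pick p₂ c₂
    with j′ , y≢x ← f₁ j with k′ , z≢y ← f₂ k with k″ , z≢x ← f₁ k′ =
    x , y , z , cl i j′ (≢-sym y≢x) , cl j′ k″ (≢-sym z≢y) , cl i k″ (≢-sym z≢x)

  triangle⇒clique : HasTriangle G → HasClique 3 G
  triangle⇒clique (x , y , z , xy , yz , xz) =
    proj₁ corners , clique (proj₂ (proj₂ corners)) , proj₁ (proj₂ corners)
    where
    IsCorner : Fin m → Set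
    IsCorner v = v ≡ x ⊎ v ≡ y ⊎ v ≡ z

    corners : ∃[ p ] ∣ p ∣ ≡ 3 × (∀ {v} → v ∈ p → IsCorner v)
    corners
      with p₁ , c₁ , f₁ ← insertVertex Subset.⊥ x ∉⊥
      with p₂ , c₂ , f₂ ← insertVertex p₁ y (λ i → case f₁ i of λ where
        (inj₁ e) → Graph.adj-irrefl G (sym e) xy
        (inj₂ j) → ∉⊥ j)
      with p₃ , c₃ , f₃ ← insertVertex p₂ z (λ i → case f₂ i of λ where
        (inj₁ e) → Graph.adj-irrefl G (sym e) yz
        (inj₂ j) → case f₁ j of λ where
          (inj₁ e) → Graph.adj-irrefl G (sym e) xz
          (inj₂ k) → ∉⊥ k)
      = p₃ , trans c₃ (cong suc (trans c₂ (cong suc (trans c₁ (cong suc (∣⊥∣≡0 m)))))) , λ i → case f₃ i of λ where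
          (inj₁ e) → inj₂ (inj₂ e)
          (inj₂ j) → case f₂ j of λ where
            (inj₁ e) → inj₂ (inj₁ e)
            (inj₂ k) → case f₁ k of λ where
              (inj₁ e) → inj₁ e
              (inj₂ l) → ⊥-elim (∉⊥ l)

    clique : ∀ {p} → (∀ {v} → v ∈ p → IsCorner v) → IsClique G p
    clique f i j ≢ with f i | f j
    ... | inj₁ refl        | inj₁ refl        = contradiction refl ≢
    ... | inj₁ refl        | inj₂ (inj₁ refl) = xy
    ... | inj₁ refl        | inj₂ (inj₂ refl) = xz
    ... | inj₂ (inj₁ refl) | inj₁ refl        = Graph.adj-sym G xy
    ... | inj₂ (inj₁ refl) | inj₂ (inj₁ refl) = contradiction refl ≢
    ... | inj₂ (inj₁ refl) | inj₂ (inj₂ refl) = yz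
    ... | inj₂ (inj₂ refl) | inj₁ refl        = Graph.adj-sym G xz
    ... | inj₂ (inj₂ refl) | inj₂ (inj₁ refl) = Graph.adj-sym G yz
    ... | inj₂ (inj₂ refl) | inj₂ (inj₂ refl) = contradiction refl ≢

-- Circular distances and the connection set

module Distances (g : ℕ) where
  open Arithmetic g

  t : ℕ
  t = 17 + 2 * g

  half₁ : (3 * t ∸ 9) / 2 ≡ 3 * h
  half₁ = trans (cong (λ a → (a ∸ 9) / 2) (trans
      (linear :⊤ (3 :* (lit 17 :+ 2 :* x₀) :≡ lit 9 :+ 2 :* (3 :* hᵉ x₀)) (g ∷ []) refl tt)
      (cong (9 +_) (*-comm 2 (3 * h))))) (m*n/n≡m (3 * h) 2)

  half₂ : (3 * t ∸ 5) / 2 ≡ 2 + 3 * h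
  half₂ = trans (cong (λ a → (a ∸ 5) / 2) (trans
      (linear :⊤ (3 :* (lit 17 :+ 2 :* x₀) :≡ lit 5 :+ 2 :* (lit 2 :+ 3 :* hᵉ x₀)) (g ∷ []) refl tt)
      (cong (5 +_) (*-comm 2 (2 + 3 * h))))) (m*n/n≡m (2 + 3 * h) 2)

  2t∸4≡2q : 2 * t ∸ 4 ≡ 2 * q
  2t∸4≡2q = cong (_∸ 4) (linear :⊤ (2 :* (lit 17 :+ 2 :* x₀) :≡ lit 4 :+ 2 :* qᵉ x₀) (g ∷ []) refl tt)

  order≡n : order t ≡ n
  order≡n = cong (_∸ 10) (linear :⊤ (5 :* (lit 17 :+ 2 :* x₀) :≡ lit 10 :+ nᵉ x₀) (g ∷ []) refl tt)

  distance : Formula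
  distance = (lit 13 :+ 2 :* x₁ :≡ x₀ :∨ lit 14 :+ 2 :* x₁ :≡ x₀)
    :∨ (lit 17 :+ 2 :* x₁ :+ lit 1 :≤ x₀ :∧ x₀ :≤ 3 :* hᵉ x₁)
    :∨ lit 2 :+ 3 :* hᵉ x₁ :≡ x₀ :∨ 2 :* qᵉ x₁ :≡ x₀

  S⇒link : ∀ {d} → S t d → Link 0 d
  S⇒link {d} s = linear distance (link x₁ (lit 0) x₀) (d ∷ g ∷ []) refl
    (Sum.map₂ (Sum.map (map₂ (λ p → ≤-trans p (≤-reflexive half₁)))
      (Sum.map (trans (sym half₂)) (trans (sym 2t∸4≡2q)))) s)

  -- The bound ⌊n / 2⌋ separates S from n - S.
  link⇒S : ∀ {d} → Link 0 d → d ≤ 2 + 5 * h → S t d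
  link⇒S {d} l p = Sum.map₂ (Sum.map (map₂ (λ p → ≤-trans p (≤-reflexive (sym half₁))))
      (Sum.map (trans half₂) (trans 2t∸4≡2q)))
    (linear (link x₁ (lit 0) x₀ :∧ x₀ :≤ lit 2 :+ 5 :* hᵉ x₁) distance (d ∷ g ∷ []) refl (l , p))

  -- `order t` equals n without being convertible to it, so the statement is made for any N equal to
  -- n. Then `residue` becomes `offset`, by `toℕ-at`.
  residue-shift : ∀ {N} → N ≡ n → (x y : Fin N) → Shift (toℕ x) (residue x y) (toℕ y)
  residue-shift refl x y = subst (λ r → Shift (toℕ x) r (toℕ y)) (toℕ-at y (n ∸ toℕ x))
      (subst (λ z → toℕ x + offset x y ≡ toℕ z ⊎ toℕ x + offset x y ≡ toℕ z + n)
        (at-offset x y) (at-shift x (offset< x y)) , toℕ<n y , offset< x y)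
    where open Cyclic n

  adjacent⇒edge : ∀ {a b r d} → Shift a r b → S t d → d ≡ r ⊎ d + r ≡ n → a < n → Edge a b
  adjacent⇒edge s p (inj₁ refl) a< = edge-shift (inj₁ (+-identityʳ _) , a< , z<s) s (inj₁ (S⇒link p))
  adjacent⇒edge {r = r} {d} s p (inj₂ e) a< =
    edge-shift (inj₁ (+-identityʳ _) , a< , z<s) s (inj₁ (link-complement {d} {r} e (S⇒link p)))

  edge⇒adjacent : ∀ {a b r d} → Shift a r b → d ≡ r ⊎ d + r ≡ n → d ≤ 2 + 5 * h → a < n → Edge a b → S t d
  edge⇒adjacent {a} {b} {r} {d} s c p a< e = link⇒S (Sum.[ (λ d≡r → subst (Link 0) (sym d≡r) linked) ,
      (λ d+r≡n → link-complement (trans (+-comm r d) d+r≡n) linked) ]′ c) p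
    where
    linked : Link 0 r
    linked = Sum.[ (λ l → l) , (λ l → contradiction (link⇒< l) λ ()) ]′
      (shift-edge (inj₁ (+-identityʳ a) , a< , z<s) s e)

  circDist-cases : ∀ {N} → N ≡ n → (x y : Fin N) →
    (circDist x y ≡ residue x y ⊎ circDist x y + residue x y ≡ n) × circDist x y ≤ 2 + 5 * h
  circDist-cases refl x y = minimum (residue x y) (proj₂ (proj₂ (residue-shift refl x y)))
    where
    bounds : ∀ {r m d} → m + r ≡ n → (r ≤ m → d ≡ r) → (m ≤ r → d ≡ m) → r ≤ m ⊎ m ≤ r →
      (d ≡ r ⊎ d + r ≡ n) × d ≤ 2 + 5 * h
    bounds {r} {m} {d} e f f′ (inj₁ p) = inj₁ (f p) ,
      linear (x₁ :+ x₀ :≡ nᵉ x₃ :∧ x₀ :≤ x₁ :∧ x₂ :≡ x₀) (x₂ :≤ lit 2 :+ 5 :* hᵉ x₃)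
        (r ∷ m ∷ d ∷ g ∷ []) refl (e , p , f p)
    bounds {r} {m} {d} e f f′ (inj₂ p) =
      linear (x₁ :+ x₀ :≡ nᵉ x₃ :∧ x₁ :≤ x₀ :∧ x₂ :≡ x₁)
        ((x₂ :≡ x₀ :∨ x₂ :+ x₀ :≡ nᵉ x₃) :∧ x₂ :≤ lit 2 :+ 5 :* hᵉ x₃)
        (r ∷ m ∷ d ∷ g ∷ []) refl (e , p , f′ p)

    minimum : ∀ r → r < n → (r ⊓ (n ∸ r) ≡ r ⊎ r ⊓ (n ∸ r) + r ≡ n) × r ⊓ (n ∸ r) ≤ 2 + 5 * h
    minimum r r<n = bounds (m∸n+n≡m (<⇒≤ r<n)) m≤n⇒m⊓n≡m m≥n⇒m⊓n≡n (≤-total r (n ∸ r))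

-- Assembly of the theorem

Properties : ∀ {N} → Graph N → ℕ → Set
Properties G t = TriangleFree G
  × IndependenceNumber G (t ∸ 1)
  × (∀ x y (x≢y : x ≢ y) → ¬ Adj G x y → HasTriangle (addEdge G x y x≢y))
  × (∀ x y → Adj G x y → HasIndependentSet t (deleteEdge G x y))

properties : ∀ g {N} (G : Graph N) → N ≡ Arithmetic.n g →
  (∀ {x y} → Adj G x y → Arithmetic.Edge g (toℕ x) (toℕ y)) →
  (∀ {x y} → Arithmetic.Edge g (toℕ x) (toℕ y) → Adj G x y) →
  Properties G (3 + 2 * (7 + g))
properties g G refl adj⇒ adj⇐ = triangle-free , Independence , addEdge-triangle , deleteEdge-independent
  where open Saturation g G adj⇒ adj⇐

circulant-properties : ∀ g 17≤t → Properties (circulantG (17 + 2 * g) 17≤t) (17 + 2 * g)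
circulant-properties g 17≤t = subst (Properties (circulantG t 17≤t)) t≡ (properties g (circulantG t 17≤t) order≡n
    (λ {x} {y} a → adjacent⇒edge (residue-shift order≡n x y) a (proj₁ (circDist-cases order≡n x y))
      (subst (toℕ x <_) order≡n (toℕ<n x)))
    (λ {x} {y} e → edge⇒adjacent (residue-shift order≡n x y) (proj₁ (circDist-cases order≡n x y))
      (proj₂ (circDist-cases order≡n x y)) (subst (toℕ x <_) order≡n (toℕ<n x)) e))
  where
  open Distances g
  t≡ : 3 + 2 * (7 + g) ≡ 17 + 2 * g
  t≡ = linear :⊤ (lit 3 :+ 2 :* hᵉ x₀ :≡ lit 17 :+ 2 :* x₀) (g ∷ []) refl tt

-- Positivity of t makes `t ∸ 1` smaller than t, so that the independence number excludes order t.
doubly-saturated : ∀ {N t} (G : Graph N) → 0 < t → Properties G t → DoublySaturatedGood 3 t G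
doubly-saturated {t = suc t} G _ (tf , (_ , α≤) , add , delete) =
  (tf ∘ clique⇒triangle G , λ (p , ind , c) → 1+n≰n (subst (_≤ t) c (α≤ p ind))) ,
  (λ x y x≢y ¬xy good → proj₁ good (triangle⇒clique (addEdge G x y x≢y) (add x y x≢y ¬xy))) ,
  (λ x y xy good → proj₂ good (delete x y xy))

odd⇒ : ∀ t → 17 ≤ t → t % 2 ≡ 1 → ∃[ g ] 17 + 2 * g ≡ t
-- From t = 2 h + 3 the integer half of t is h + 1 = 8 + g.
odd⇒ t 17≤t odd = t / 2 ∸ 8 ,
  linear (x₀ :≡ lit 1 :+ 2 :* x₁ :∧ x₂ :+ lit 8 :≡ x₁) (lit 17 :+ 2 :* x₂ :≡ x₀)
    (t ∷ t / 2 ∷ t / 2 ∸ 8 ∷ []) refl (e , m∸n+n≡m 8≤t/2)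
  where
  e : t ≡ 1 + 2 * (t / 2)
  e = trans (m≡m%n+[m/n]*n t 2) (cong₂ _+_ odd (*-comm (t / 2) 2))

  8≤t/2 : 8 ≤ t / 2
  8≤t/2 = linear (x₀ :≡ lit 1 :+ 2 :* x₁ :∧ lit 17 :≤ x₀) (lit 8 :≤ x₁) (t ∷ t / 2 ∷ []) refl (e , 17≤t)

theorem1p1 : (t : ℕ) (17≤t : 17 ≤ t) → t % 2 ≡ 1 →
    let G = circulantG t 17≤t in
    DoublySaturatedGood 3 t G
    × TriangleFree G
    × IndependenceNumber G (t ∸ 1)
    × (∀ x y (x≢y : x ≢ y) → ¬ Adj G x y → HasTriangle (addEdge G x y x≢y))
    × (∀ x y → Adj G x y → HasIndependentSet t (deleteEdge G x y))
theorem1p1 t 17≤t odd with odd⇒ t 17≤t odd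
... | g , refl = doubly-saturated (circulantG (17 + 2 * g) 17≤t) z<s (circulant-properties g 17≤t) , circulant-properties g 17≤t
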